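{- Let $<_t$ be a term order on $\binom{[n]}{2}$ such that $\{a,b\}<_t\{a',b'\}$ whenever $a+b<a'+b'$. Let $G$ be a graph on $[n]$ such that every $3$-subset of $[n]$ contains an edge of $G$. Then the exterior shifting $E(G)^{<_t}$ contains $B(n)=\{\{a,b\}:1\le a<b\le n,\ a+b\le n\}$.
   Context: Partial order on $k$-subsets of $[n]$: for $S=\{s_1<\dots<s_k\}$, $T=\{t_1<\dots<t_k\}$, $S\le T$ iff $s_i\le t_i$ for all $i$. A term order on $\binom{[n]}{k}$ is a linear order extending this partial order. Let $X=(x_{ij})$ be an $n\times n$ matrix of independent indeterminates over $\mathbb{Q}$ and $C_k(X)$ its $k$-th compound matrix (entries $c_{S,T}=\det(x_{ij})_{i\in S,j\in T}$ for $k$-subsets $S,T$). For $\mathcal F\subseteq\binom{[n]}{k}$, the exterior shifting $\mathcal F^{<_t}$ is obtained greedily: go through all $S\in\binom{[n]}{k}$ in increasing $<_t$ order and put $S$ into $\mathcal F^{<_t}$ iff the row of $C_k(X)$ indexed by $S$, restricted to the columns indexed by $\mathcal F$, is linearly independent (over $\mathbb{Q}(x_{ij})$) of the previously selected such rows. Thus $|\mathcal F^{<_t}|=|\mathcal F|$. -}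

module Defs where

open import Level using (0ℓ)
open import Algebra.Bundles using (CommutativeRing; Semiring)
open import Algebra.Structures using (IsCommutativeRing)
import Algebra.Definitions.RawMonoid as RawMonoidDefs
import Algebra.Definitions.RawSemiring as RawSemiringDefs
import Algebra.Properties.Ring as RingProperties
import Algebra.Solver.Ring.NaturalCoefficients.Default as NaturalCoefficients
open import Data.Empty using (⊥-elim)
open import Data.Fin using (Fin; zero; suc; toℕ; punchIn; combine)
import Data.Fin as Fin
open import Data.Fin.Induction using (spo-wellFounded)
open import Data.Fin.Properties using (combine-injective)
open import Data.List using (List; []; _∷_)
import Data.List as List
open import Data.List.Relation.Unary.All using (All)
open import Data.Nat using (ℕ; zero; suc)
import Data.Nat as ℕ
open import Data.Product using (Σ; ∃; _×_; _,_; proj₁; proj₂)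
open import Data.Rational using (ℚ)
import Data.Rational as ℚ
import Data.Rational.Properties as ℚ
open import Data.Sum using (_⊎_; inj₁; inj₂; [_,_]′)
import Data.Sum as Sum
open import Data.Vec using (Vec; []; _∷_; lookup)
import Data.Vec.Membership.Propositional as Vec
open import Function using (_∘_; _on_)
open import Induction.WellFounded using (WellFounded; Acc; acc; module Subrelation)
import Relation.Binary.Construct.On as On
open import Relation.Binary using (Rel; Decidable; Symmetric; Irreflexive;
  IsEquivalence; IsStrictPartialOrder; IsStrictTotalOrder)
open import Relation.Binary.PropositionalEquality
  using (_≡_; _≢_; refl; sym; trans; cong; cong₂; subst; resp₂; isEquivalence)
open import Relation.Nullary using (¬_; yes; no)
open import Relation.Unary using (Pred)

record IntegralDomain : Set₁ where
  field
    commutativeRing : CommutativeRing 0ℓ 0ℓ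
  open CommutativeRing commutativeRing public
  field
    _≟_            : Decidable _≈_
    1≉0            : ¬ (1# ≈ 0#)
    noZeroDivisors : ∀ x y → x * y ≈ 0# → x ≈ 0# ⊎ y ≈ 0#

ℚ-domain : IntegralDomain
ℚ-domain = record
  { commutativeRing = ℚ.+-*-commutativeRing
  ; _≟_ = ℚ._≟_
  ; 1≉0 = λ ()
  ; noZeroDivisors = nzd
  }
  where
  nzd : ∀ x y → x ℚ.* y ≡ ℚ.0ℚ → x ≡ ℚ.0ℚ ⊎ y ≡ ℚ.0ℚ
  nzd x y xy≡0 with x ℚ.≟ ℚ.0ℚ
  ... | yes x≡0 = inj₁ x≡0
  ... | no  x≢0 = inj₂ (trans (sym (ℚ.*-identityˡ y))
      (trans (cong (ℚ._* y) (sym (ℚ.*-inverseˡ x)))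
      (trans (ℚ.*-assoc (ℚ.1/ x) x y)
      (trans (cong ((ℚ.1/ x) ℚ.*_) xy≡0) (ℚ.*-zeroʳ (ℚ.1/ x))))))
    where instance _ = ℚ.≢-nonZero x≢0

module RingIdentities (R : CommutativeRing 0ℓ 0ℓ) where
  private
    module R = CommutativeRing R
    open NaturalCoefficients R.commutativeSemiring using (solve; _:=_; _:+_; _:*_; con)
    open R using (_≈_; _+_; _*_; -_; 0#; 1#)
    open RingProperties R.ring using (-‿distribˡ-*; -‿distribʳ-*)

  swap : ∀ a b c d → (a + b) + (c + d) ≈ (a + c) + (b + d)
  swap = solve 4 (λ a b c d →
    (a :+ b) :+ (c :+ d) := (a :+ c) :+ (b :+ d)) R.refl
  trans₁ : ∀ b a c → b * (a * c) ≈ (a * b) * c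
  trans₁ = solve 3 (λ b a c →
    b :* (a :* c) := (a :* b) :* c) R.refl
  trans₂ : ∀ a b c → (a * b) * c ≈ (a * c) * b
  trans₂ = solve 3 (λ a b c →
    (a :* b) :* c := (a :* c) :* b) R.refl
  trans₃ : ∀ a b c → (a * b) * c ≈ b * (a * c)
  trans₃ = solve 3 (λ a b c →
    (a :* b) :* c := b :* (a :* c)) R.refl
  ⊕-cong₁ : ∀ a b c d b′ d′ → (a * d + c * b) * (b′ * d′)
     ≈ (a * b′) * (d * d′) + (c * d′) * (b * b′)
  ⊕-cong₁ = solve 6 (λ a b c d b′ d′ →
    (a :* d :+ c :* b) :* (b′ :* d′)
    := (a :* b′) :* (d :* d′) :+ (c :* d′) :* (b :* b′)) R.refl
  ⊕-cong₂ : ∀ a′ b c′ d b′ d′ → (a′ * b) * (d * d′) + (c′ * d) * (b * b′)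
     ≈ (a′ * d′ + c′ * b′) * (b * d)
  ⊕-cong₂ = solve 6 (λ a′ b c′ d b′ d′ →
    (a′ :* b) :* (d :* d′) :+ (c′ :* d) :* (b :* b′)
    := (a′ :* d′ :+ c′ :* b′) :* (b :* d)) R.refl
  medial : ∀ a c b d → (a * c) * (b * d) ≈ (a * b) * (c * d)
  medial = solve 4 (λ a c b d →
    (a :* c) :* (b :* d) := (a :* b) :* (c :* d)) R.refl
  +-assoc′ : ∀ a b c d e f →
    ((a * d + c * b) * f + e * (b * d)) * (b * (d * f))
    ≈ (a * (d * f) + (c * f + e * d) * b) * ((b * d) * f)
  +-assoc′ = solve 6 (λ a b c d e f →
    ((a :* d :+ c :* b) :* f :+ e :* (b :* d)) :* (b :* (d :* f))
    := (a :* (d :* f) :+ (c :* f :+ e :* d) :* b) :* ((b :* d) :* f)) R.refl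
  +-comm′ : ∀ a b c d → (a * d + c * b) * (d * b) ≈ (c * b + a * d) * (b * d)
  +-comm′ = solve 4 (λ a b c d →
    (a :* d :+ c :* b) :* (d :* b) := (c :* b :+ a :* d) :* (b :* d)) R.refl
  *-assoc′ : ∀ a b c d e f →
    ((a * c) * e) * (b * (d * f)) ≈ (a * (c * e)) * ((b * d) * f)
  *-assoc′ = solve 6 (λ a b c d e f →
    ((a :* c) :* e) :* (b :* (d :* f))
    := (a :* (c :* e)) :* ((b :* d) :* f)) R.refl
  *-idˡ : ∀ a b → (1# * a) * b ≈ a * (1# * b)
  *-idˡ = solve 2 (λ a b →
    (con 1 :* a) :* b := a :* (con 1 :* b)) R.refl
  *-idʳ : ∀ a b → (a * 1#) * b ≈ a * (b * 1#)
  *-idʳ = solve 2 (λ a b →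
    (a :* con 1) :* b := a :* (b :* con 1)) R.refl
  *-comm′ : ∀ a b c d → (a * c) * (d * b) ≈ (c * a) * (b * d)
  *-comm′ = solve 4 (λ a b c d →
    (a :* c) :* (d :* b) := (c :* a) :* (b :* d)) R.refl
  distribˡ′ : ∀ a b c d e f →
    (a * (c * f + e * d)) * ((b * d) * (b * f))
    ≈ ((a * c) * (b * f) + (a * e) * (b * d)) * (b * (d * f))
  distribˡ′ = solve 6 (λ a b c d e f →
    (a :* (c :* f :+ e :* d)) :* ((b :* d) :* (b :* f))
    := ((a :* c) :* (b :* f) :+ (a :* e) :* (b :* d)) :* (b :* (d :* f))) R.refl
  distribʳ′ : ∀ a b c d e f →
    ((c * f + e * d) * a) * ((d * b) * (f * b))
    ≈ ((c * a) * (f * b) + (e * a) * (d * b)) * ((d * f) * b)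
  distribʳ′ = solve 6 (λ a b c d e f →
    ((c :* f :+ e :* d) :* a) :* ((d :* b) :* (f :* b))
    := ((c :* a) :* (f :* b) :+ (e :* a) :* (d :* b)) :* ((d :* f) :* b)) R.refl
  inverse-eq : ∀ a b → (b * a) * 1# ≈ 1# * (a * b)
  inverse-eq = solve 2 (λ a b →
    (b :* a) :* con 1 := con 1 :* (a :* b)) R.refl
  expand : ∀ x y z → x * (y + - z) ≈ x * y + - (x * z)
  expand x y z = R.trans (R.distribˡ x y (- z)) (R.+-congˡ (R.sym (-‿distribʳ-* x z)))
  ⊖-cong₁ : ∀ a d → (- a) * d ≈ - (a * d)
  ⊖-cong₁ a d = R.sym (-‿distribˡ-* a d)
  +-idˡ : ∀ a b → (0# * b + a * 1#) * b ≈ a * (1# * b)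
  +-idˡ a b = R.trans (R.*-congʳ (R.trans (R.+-congʳ (R.zeroˡ b)) (R.+-identityˡ _))) (R.*-assoc a 1# b)
  +-idʳ : ∀ a b → (a * 1# + 0# * b) * b ≈ a * (b * 1#)
  +-idʳ a b = R.trans (R.*-congʳ (R.+-comm _ _)) (R.trans (+-idˡ a b) (R.*-congˡ (R.*-comm 1# b)))

module Polynomial (R : CommutativeRing 0ℓ 0ℓ) where
  private
    module R = CommutativeRing R
    open R using (Carrier; _≈_; _+_; _*_; -_; 0#; 1#)
    open RingIdentities R

  -- a₀ ∷ a₁ ∷ … ∷ [] is a₀ + a₁ x + …; trailing zeros are allowed, and are
  -- ignored by the equality _≈ₚ_.
  Poly : Set
  Poly = List Carrier

  coeff : Poly → ℕ → Carrier
  coeff []      _       = 0#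
  coeff (a ∷ p) zero    = a
  coeff (a ∷ p) (suc i) = coeff p i

  infix 4 _≈ₚ_
  record _≈ₚ_ (p q : Poly) : Set where
    constructor coeffs
    field at : ∀ i → coeff p i ≈ coeff q i
  open _≈ₚ_ public

  infixl 6 _+ₚ_
  infixl 7 _*ₚ_ _·_

  _+ₚ_ : Poly → Poly → Poly
  []      +ₚ q       = q
  (a ∷ p) +ₚ []      = a ∷ p
  (a ∷ p) +ₚ (b ∷ q) = a + b ∷ (p +ₚ q)

  -ₚ_ : Poly → Poly
  -ₚ_ = List.map (-_)

  _·_ : Carrier → Poly → Poly
  a · p = List.map (a *_) p

  _*ₚ_ : Poly → Poly → Poly
  []      *ₚ q = []
  (a ∷ p) *ₚ q = a · q +ₚ (0# ∷ p *ₚ q)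

  0ₚ 1ₚ : Poly
  0ₚ = []
  1ₚ = 1# ∷ []

  coeff-+ : ∀ p q i → coeff (p +ₚ q) i ≈ coeff p i + coeff q i
  coeff-+ []      q       i       = R.sym (R.+-identityˡ _)
  coeff-+ (a ∷ p) []      i       = R.sym (R.+-identityʳ _)
  coeff-+ (a ∷ p) (b ∷ q) zero    = R.refl
  coeff-+ (a ∷ p) (b ∷ q) (suc i) = coeff-+ p q i

  coeff-- : ∀ p i → coeff (-ₚ p) i ≈ - coeff p i
  coeff-- []      i       = R.sym (RingProperties.-0#≈0# R.ring)
  coeff-- (a ∷ p) zero    = R.refl
  coeff-- (a ∷ p) (suc i) = coeff-- p i

  coeff-· : ∀ a p i → coeff (a · p) i ≈ a * coeff p i
  coeff-· a []      i       = R.sym (R.zeroʳ a)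
  coeff-· a (b ∷ p) zero    = R.refl
  coeff-· a (b ∷ p) (suc i) = coeff-· a p i

  ≈ₚ-refl : ∀ {p} → p ≈ₚ p
  ≈ₚ-refl = coeffs λ _ → R.refl

  ≈ₚ-sym : ∀ {p q} → p ≈ₚ q → q ≈ₚ p
  ≈ₚ-sym e = coeffs λ i → R.sym (at e i)

  ≈ₚ-trans : ∀ {p q r} → p ≈ₚ q → q ≈ₚ r → p ≈ₚ r
  ≈ₚ-trans e f = coeffs λ i → R.trans (at e i) (at f i)

  ∷-cong : ∀ {a b p q} → a ≈ b → p ≈ₚ q → a ∷ p ≈ₚ b ∷ q
  ∷-cong e f = coeffs λ { zero → e ; (suc i) → at f i }

  tail-≈ : ∀ {a b p q} → a ∷ p ≈ₚ b ∷ q → p ≈ₚ q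
  tail-≈ e = coeffs λ i → at e (suc i)

  ∷≈0 : ∀ {a p} → a ≈ 0# → p ≈ₚ 0ₚ → a ∷ p ≈ₚ 0ₚ
  ∷≈0 e f = coeffs λ { zero → e ; (suc i) → at f i }

  tail≈0 : ∀ {a p} → a ∷ p ≈ₚ 0ₚ → p ≈ₚ 0ₚ
  tail≈0 e = coeffs λ i → at e (suc i)

  +ₚ-cong : ∀ {p p′ q q′} → p ≈ₚ p′ → q ≈ₚ q′ → p +ₚ q ≈ₚ p′ +ₚ q′
  +ₚ-cong {p} {p′} {q} {q′} e f = coeffs λ i →
    R.trans (coeff-+ p q i)
    (R.trans (R.+-cong (at e i) (at f i)) (R.sym (coeff-+ p′ q′ i)))

  ·-cong : ∀ {a b p q} → a ≈ b → p ≈ₚ q → a · p ≈ₚ b · q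
  ·-cong {a} {b} {p} {q} e f = coeffs λ i →
    R.trans (coeff-· a p i)
    (R.trans (R.*-cong e (at f i)) (R.sym (coeff-· b q i)))

  -ₚ-cong : ∀ {p q} → p ≈ₚ q → -ₚ p ≈ₚ -ₚ q
  -ₚ-cong {p} {q} e = coeffs λ i →
    R.trans (coeff-- p i) (R.trans (R.-‿cong (at e i)) (R.sym (coeff-- q i)))

  +ₚ-assoc : ∀ p q r → (p +ₚ q) +ₚ r ≈ₚ p +ₚ (q +ₚ r)
  +ₚ-assoc p q r = coeffs λ i →
    R.trans (coeff-+ (p +ₚ q) r i)
    (R.trans (R.+-congʳ (coeff-+ p q i))
    (R.trans (R.+-assoc _ _ _)
    (R.trans (R.+-congˡ (R.sym (coeff-+ q r i)))
             (R.sym (coeff-+ p (q +ₚ r) i)))))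

  +ₚ-comm : ∀ p q → p +ₚ q ≈ₚ q +ₚ p
  +ₚ-comm p q = coeffs λ i →
    R.trans (coeff-+ p q i) (R.trans (R.+-comm _ _) (R.sym (coeff-+ q p i)))

  +ₚ-identityʳ : ∀ p → p +ₚ 0ₚ ≈ₚ p
  +ₚ-identityʳ p = +ₚ-comm p 0ₚ

  -ₚ-inverseˡ : ∀ p → (-ₚ p) +ₚ p ≈ₚ 0ₚ
  -ₚ-inverseˡ p = coeffs λ i →
    R.trans (coeff-+ (-ₚ p) p i)
    (R.trans (R.+-congʳ (coeff-- p i)) (R.-‿inverseˡ _))

  +ₚ-interchange : ∀ p q r s → (p +ₚ q) +ₚ (r +ₚ s) ≈ₚ (p +ₚ r) +ₚ (q +ₚ s)
  +ₚ-interchange p q r s = coeffs λ i →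
    R.trans (coeff-++ p q r s i)
    (R.trans (swap _ _ _ _) (R.sym (coeff-++ p r q s i)))
    where
    coeff-++ : ∀ p q r s i → coeff ((p +ₚ q) +ₚ (r +ₚ s)) i
           ≈ (coeff p i + coeff q i) + (coeff r i + coeff s i)
    coeff-++ p q r s i = R.trans (coeff-+ (p +ₚ q) (r +ₚ s) i)
                               (R.+-cong (coeff-+ p q i) (coeff-+ r s i))

  ·-distribˡ : ∀ a p q → a · (p +ₚ q) ≈ₚ a · p +ₚ a · q
  ·-distribˡ a p q = coeffs λ i →
    R.trans (coeff-· a (p +ₚ q) i)
    (R.trans (R.*-congˡ (coeff-+ p q i))
    (R.trans (R.distribˡ _ _ _)
    (R.trans (R.sym (R.+-cong (coeff-· a p i) (coeff-· a q i)))
             (R.sym (coeff-+ (a · p) (a · q) i)))))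

  ·-assoc : ∀ a b p → (a * b) · p ≈ₚ a · (b · p)
  ·-assoc a b p = coeffs λ i →
    R.trans (coeff-· (a * b) p i)
    (R.trans (R.*-assoc _ _ _)
    (R.trans (R.*-congˡ (R.sym (coeff-· b p i)))
             (R.sym (coeff-· a (b · p) i))))

  0·≈0 : ∀ {a} p → a ≈ 0# → a · p ≈ₚ 0ₚ
  0·≈0 {a} p e = coeffs λ i →
    R.trans (coeff-· a p i) (R.trans (R.*-congʳ e) (R.zeroˡ _))

  1·≈ : ∀ p → 1# · p ≈ₚ p
  1·≈ p = coeffs λ i → R.trans (coeff-· 1# p i) (R.*-identityˡ _)

  *ₚ-zeroʳ : ∀ p → p *ₚ 0ₚ ≈ₚ 0ₚ
  *ₚ-zeroʳ []      = ≈ₚ-refl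
  *ₚ-zeroʳ (a ∷ p) = ∷≈0 R.refl (*ₚ-zeroʳ p)

  0∷-*ₚ : ∀ {a} p q → a ≈ 0# → (a ∷ p) *ₚ q ≈ₚ 0# ∷ p *ₚ q
  0∷-*ₚ p q e = +ₚ-cong (0·≈0 q e) ≈ₚ-refl

  *ₚ-∷ʳ : ∀ p b q → p *ₚ (b ∷ q) ≈ₚ b · p +ₚ (0# ∷ p *ₚ q)
  *ₚ-∷ʳ []      b q = ≈ₚ-sym (∷≈0 R.refl ≈ₚ-refl)
  *ₚ-∷ʳ (a ∷ p) b q = ∷-cong (R.+-congʳ (R.*-comm a b))
    (≈ₚ-trans (+ₚ-cong (≈ₚ-refl {a · q}) (*ₚ-∷ʳ p b q))
    (≈ₚ-trans (≈ₚ-sym (+ₚ-assoc (a · q) (b · p) _))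
    (≈ₚ-trans (+ₚ-cong (+ₚ-comm (a · q) (b · p)) ≈ₚ-refl)
              (+ₚ-assoc (b · p) (a · q) _))))

  *ₚ-comm : ∀ p q → p *ₚ q ≈ₚ q *ₚ p
  *ₚ-comm []      q = ≈ₚ-sym (*ₚ-zeroʳ q)
  *ₚ-comm (a ∷ p) q =
    ≈ₚ-trans (+ₚ-cong (≈ₚ-refl {a · q}) (∷-cong R.refl (*ₚ-comm p q)))
             (≈ₚ-sym (*ₚ-∷ʳ q a p))

  *ₚ-congˡ : ∀ p {q r} → q ≈ₚ r → p *ₚ q ≈ₚ p *ₚ r
  *ₚ-congˡ []      e = ≈ₚ-refl
  *ₚ-congˡ (a ∷ p) e = +ₚ-cong (·-cong R.refl e) (∷-cong R.refl (*ₚ-congˡ p e))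

  *ₚ-cong : ∀ {p p′ q q′} → p ≈ₚ p′ → q ≈ₚ q′ → p *ₚ q ≈ₚ p′ *ₚ q′
  *ₚ-cong {p} {p′} {q} {q′} e f =
    ≈ₚ-trans (*ₚ-congˡ p f)
    (≈ₚ-trans (*ₚ-comm p q′)
    (≈ₚ-trans (*ₚ-congˡ q′ e) (*ₚ-comm q′ p′)))

  *ₚ-distribˡ : ∀ p q r → p *ₚ (q +ₚ r) ≈ₚ p *ₚ q +ₚ p *ₚ r
  *ₚ-distribˡ []      q r = ≈ₚ-refl
  *ₚ-distribˡ (a ∷ p) q r =
    ≈ₚ-trans (+ₚ-cong (·-distribˡ a q r)
                      (∷-cong (R.sym (R.+-identityˡ 0#)) (*ₚ-distribˡ p q r)))
             (+ₚ-interchange (a · q) (a · r) (0# ∷ p *ₚ q) (0# ∷ p *ₚ r))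

  *ₚ-distribʳ : ∀ p q r → (q +ₚ r) *ₚ p ≈ₚ q *ₚ p +ₚ r *ₚ p
  *ₚ-distribʳ p q r =
    ≈ₚ-trans (*ₚ-comm (q +ₚ r) p)
    (≈ₚ-trans (*ₚ-distribˡ p q r) (+ₚ-cong (*ₚ-comm p q) (*ₚ-comm p r)))

  ·-*ₚ : ∀ a p q → (a · p) *ₚ q ≈ₚ a · (p *ₚ q)
  ·-*ₚ a []      q = ≈ₚ-refl
  ·-*ₚ a (b ∷ p) q =
    ≈ₚ-trans (+ₚ-cong (·-assoc a b q)
                      (∷-cong (R.sym (R.zeroʳ a)) (·-*ₚ a p q)))
             (≈ₚ-sym (·-distribˡ a (b · q) (0# ∷ p *ₚ q)))

  *ₚ-assoc : ∀ p q r → (p *ₚ q) *ₚ r ≈ₚ p *ₚ (q *ₚ r)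
  *ₚ-assoc []      q r = ≈ₚ-refl
  *ₚ-assoc (a ∷ p) q r =
    ≈ₚ-trans (*ₚ-distribʳ r (a · q) (0# ∷ p *ₚ q))
             (+ₚ-cong (·-*ₚ a q r)
                      (≈ₚ-trans (0∷-*ₚ (p *ₚ q) r R.refl)
                                (∷-cong R.refl (*ₚ-assoc p q r))))

  *ₚ-identityˡ : ∀ p → 1ₚ *ₚ p ≈ₚ p
  *ₚ-identityˡ p =
    ≈ₚ-trans (+ₚ-cong (1·≈ p) (∷≈0 R.refl ≈ₚ-refl)) (+ₚ-identityʳ p)

  isCommutativeRing : IsCommutativeRing _≈ₚ_ _+ₚ_ _*ₚ_ -ₚ_ 0ₚ 1ₚ
  isCommutativeRing = record
    { isRing = record
      { +-isAbelianGroup = record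
        { isGroup = record
          { isMonoid = record
            { isSemigroup = record
              { isMagma = record
                { isEquivalence = record
                  { refl = ≈ₚ-refl ; sym = ≈ₚ-sym ; trans = ≈ₚ-trans }
                ; ∙-cong = +ₚ-cong
                }
              ; assoc = +ₚ-assoc
              }
            ; identity = (λ _ → ≈ₚ-refl) , +ₚ-identityʳ
            }
          ; inverse = -ₚ-inverseˡ
                    , λ p → ≈ₚ-trans (+ₚ-comm p (-ₚ p)) (-ₚ-inverseˡ p)
          ; ⁻¹-cong = -ₚ-cong
          }
        ; comm = +ₚ-comm
        }
      ; *-cong = *ₚ-cong
      ; *-assoc = *ₚ-assoc
      ; *-identity = *ₚ-identityˡ
                   , λ p → ≈ₚ-trans (*ₚ-comm p 1ₚ) (*ₚ-identityˡ p)
      ; distrib = *ₚ-distribˡ , *ₚ-distribʳ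
      }
    ; *-comm = *ₚ-comm
    }

  polynomialRing : CommutativeRing 0ℓ 0ℓ
  polynomialRing = record { isCommutativeRing = isCommutativeRing }

module PolynomialDomain (D : IntegralDomain) where
  private module D = IntegralDomain D
  open Polynomial D.commutativeRing

  _≟ₚ_ : Decidable _≈ₚ_
  [] ≟ₚ [] = yes ≈ₚ-refl
  [] ≟ₚ (b ∷ q) with b D.≟ D.0# | [] ≟ₚ q
  ... | yes e | yes f = yes (≈ₚ-sym (∷≈0 e (≈ₚ-sym f)))
  ... | no ¬e | _     = no λ h → ¬e (D.sym (at h 0))
  ... | yes _ | no ¬f = no λ h → ¬f (coeffs λ i → at h (suc i))
  (a ∷ p) ≟ₚ [] with a D.≟ D.0# | p ≟ₚ []
  ... | yes e | yes f = yes (∷≈0 e f)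
  ... | no ¬e | _     = no λ h → ¬e (at h 0)
  ... | yes _ | no ¬f = no λ h → ¬f (coeffs λ i → at h (suc i))
  (a ∷ p) ≟ₚ (b ∷ q) with a D.≟ b | p ≟ₚ q
  ... | yes e | yes f = yes (∷-cong e f)
  ... | no ¬e | _     = no λ h → ¬e (at h 0)
  ... | yes _ | no ¬f = no λ h → ¬f (tail-≈ h)

  noZeroDivisorsₚ : ∀ p q → p *ₚ q ≈ₚ 0ₚ → p ≈ₚ 0ₚ ⊎ q ≈ₚ 0ₚ
  noZeroDivisorsₚ []      q       _ = inj₁ ≈ₚ-refl
  noZeroDivisorsₚ (a ∷ p) []      _ = inj₂ ≈ₚ-refl
  noZeroDivisorsₚ (a ∷ p) (b ∷ q) h =
    [ (λ a≈0 → Sum.map₁ (∷≈0 a≈0) (noZeroDivisorsₚ p (b ∷ q)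
        (tail≈0 (≈ₚ-trans (≈ₚ-sym (0∷-*ₚ p (b ∷ q) a≈0)) h))))
    , (λ b≈0 → Sum.map₂ (∷≈0 b≈0) (noZeroDivisorsₚ (a ∷ p) q
        (tail≈0 (≈ₚ-trans (≈ₚ-sym (+ₚ-cong (0·≈0 (a ∷ p) b≈0) ≈ₚ-refl))
                (≈ₚ-trans (≈ₚ-sym (*ₚ-∷ʳ (a ∷ p) b q)) h)))))
    ]′ (D.noZeroDivisors a b (D.trans (D.sym (D.+-identityʳ _)) (at h 0)))

  polynomialDomain : IntegralDomain
  polynomialDomain = record
    { commutativeRing = polynomialRing
    ; _≟_ = _≟ₚ_
    ; 1≉0 = λ h → D.1≉0 (at h 0)
    ; noZeroDivisors = noZeroDivisorsₚ
    }

-- ℚ[x₁, …, xₘ], as ℚ[x₁]…[xₘ]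
ℚ[x]_ : ℕ → IntegralDomain
ℚ[x] zero  = ℚ-domain
ℚ[x] suc m = PolynomialDomain.polynomialDomain (ℚ[x] m)

-- The outermost variable has index zero; a list with one entry is a constant.
var : ∀ {m} → Fin m → IntegralDomain.Carrier (ℚ[x] m)
var {suc m} zero    = IntegralDomain.0# (ℚ[x] m) ∷ IntegralDomain.1# (ℚ[x] m) ∷ []
var {suc m} (suc i) = var i ∷ []

module FractionField (D : IntegralDomain) where
  private
    module D = IntegralDomain D
    open D using (Carrier; _≈_; _+_; _*_; -_; 0#; 1#)
    open RingIdentities D.commutativeRing

  record Fraction : Set where
    constructor fraction
    field
      num   : Carrier
      den   : Carrier
      den≉0 : ¬ (den ≈ 0#)
  open Fraction public

  infix 4 _≃_
  record _≃_ (p q : Fraction) : Set where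
    constructor cross
    field crossEq : num p * den q ≈ num q * den p
  open _≃_ public

  *-≉0 : ∀ {x y} → ¬ (x ≈ 0#) → ¬ (y ≈ 0#) → ¬ (x * y ≈ 0#)
  *-≉0 {x} {y} x≉0 y≉0 xy≈0 with D.noZeroDivisors x y xy≈0
  ... | inj₁ x≈0 = x≉0 x≈0
  ... | inj₂ y≈0 = y≉0 y≈0

  embed : Carrier → Fraction
  embed x = fraction x 1# D.1≉0

  _⊕_ _⊗_ : Fraction → Fraction → Fraction
  p ⊕ q = fraction (num p * den q + num q * den p) (den p * den q)
                   (*-≉0 (den≉0 p) (den≉0 q))
  p ⊗ q = fraction (num p * num q) (den p * den q) (*-≉0 (den≉0 p) (den≉0 q))

  ⊖_ : Fraction → Fraction
  ⊖ p = fraction (- num p) (den p) (den≉0 p)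

  cancelˡ : ∀ x y z → ¬ (x ≈ 0#) → x * y ≈ x * z → y ≈ z
  cancelˡ x y z x≉0 xy≈xz
    with D.noZeroDivisors x (y + - z)
           (D.trans (expand x y z)
           (D.trans (D.+-congʳ xy≈xz) (D.-‿inverseʳ (x * z))))
  ... | inj₁ x≈0   = ⊥-elim (x≉0 x≈0)
  ... | inj₂ y-z≈0 =
    D.trans (split y z) (D.trans (D.+-congʳ y-z≈0) (D.+-identityˡ z))
    where
    split : ∀ y z → y ≈ (y + - z) + z
    split y z = D.sym (D.trans (D.+-assoc y (- z) z)
                (D.trans (D.+-congˡ (D.-‿inverseˡ z)) (D.+-identityʳ y)))

  ≃-isEquivalence : IsEquivalence _≃_
  ≃-isEquivalence = record
    { refl  = cross D.refl
    ; sym   = λ e → cross (D.sym (crossEq e))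
    ; trans = λ {p} {q} {r} e f → cross (cancelˡ (den q) _ _ (den≉0 q)
        (D.trans (trans₁ (den q) (num p) (den r))
        (D.trans (D.*-congʳ (crossEq e))
        (D.trans (trans₂ (num q) (den p) (den r))
        (D.trans (D.*-congʳ (crossEq f))
                 (trans₃ (num r) (den q) (den p)))))))
    }

  ⊕-cong : ∀ {p p′ q q′} → p ≃ p′ → q ≃ q′ → (p ⊕ q) ≃ (p′ ⊕ q′)
  ⊕-cong {fraction a b _} {fraction a′ b′ _} {fraction c d _} {fraction c′ d′ _}
    (cross e) (cross f) = cross
    (D.trans (⊕-cong₁ a b c d b′ d′)
    (D.trans (D.+-cong (D.*-congʳ e) (D.*-congʳ f))
             (⊕-cong₂ a′ b c′ d b′ d′)))

  ⊗-cong : ∀ {p p′ q q′} → p ≃ p′ → q ≃ q′ → (p ⊗ q) ≃ (p′ ⊗ q′)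
  ⊗-cong {fraction a b _} {fraction a′ b′ _} {fraction c d _} {fraction c′ d′ _}
    (cross e) (cross f) = cross
    (D.trans (medial a c b′ d′) (D.trans (D.*-cong e f) (medial a′ b c′ d)))

  ⊖-cong : ∀ {p q} → p ≃ q → (⊖ p) ≃ (⊖ q)
  ⊖-cong {fraction a b _} {fraction c d _} (cross e) = cross
    (D.trans (⊖-cong₁ a d) (D.trans (D.-‿cong e) (D.sym (⊖-cong₁ c b))))

  isCommutativeRing : IsCommutativeRing _≃_ _⊕_ _⊗_ ⊖_ (embed 0#) (embed 1#)
  isCommutativeRing = record
    { isRing = record
      { +-isAbelianGroup = record
        { isGroup = record
          { isMonoid = record
            { isSemigroup = record
              { isMagma = record
                { isEquivalence = ≃-isEquivalence ; ∙-cong = ⊕-cong }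
              ; assoc = λ { (fraction a b _) (fraction c d _) (fraction e f _) →
                  cross (+-assoc′ a b c d e f) }
              }
            ; identity = (λ { (fraction a b _) → cross (+-idˡ a b) })
                       , (λ { (fraction a b _) → cross (+-idʳ a b) })
            }
          ; inverse = (λ { (fraction a b _) → cross (+-invˡ a b) })
                    , (λ { (fraction a b _) → cross (+-invʳ a b) })
          ; ⁻¹-cong = ⊖-cong
          }
        ; comm = λ { (fraction a b _) (fraction c d _) → cross (+-comm′ a b c d) }
        }
      ; *-cong = ⊗-cong
      ; *-assoc = λ { (fraction a b _) (fraction c d _) (fraction e f _) →
          cross (*-assoc′ a b c d e f) }
      ; *-identity = (λ { (fraction a b _) → cross (*-idˡ a b) })
                   , (λ { (fraction a b _) → cross (*-idʳ a b) })
      ; distrib =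
          (λ { (fraction a b _) (fraction c d _) (fraction e f _) →
               cross (distribˡ′ a b c d e f) })
        , (λ { (fraction a b _) (fraction c d _) (fraction e f _) →
               cross (distribʳ′ a b c d e f) })
      }
    ; *-comm = λ { (fraction a b _) (fraction c d _) → cross (*-comm′ a b c d) }
    }
    where
    inverse : ∀ x y → x ≈ 0# → x * 1# ≈ 0# * y
    inverse x y x≈0 = D.trans (D.*-identityʳ x) (D.trans x≈0 (D.sym (D.zeroˡ y)))
    +-invˡ : ∀ a b → ((- a) * b + a * b) * 1# ≈ 0# * (b * b)
    +-invˡ a b = inverse _ _ (D.trans (D.sym (D.distribʳ b (- a) a))
                 (D.trans (D.*-congʳ (D.-‿inverseˡ a)) (D.zeroˡ b)))
    +-invʳ : ∀ a b → (a * b + (- a) * b) * 1# ≈ 0# * (b * b)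
    +-invʳ a b = inverse _ _ (D.trans (D.sym (D.distribʳ b a (- a)))
                 (D.trans (D.*-congʳ (D.-‿inverseʳ a)) (D.zeroˡ b)))

  fractionField : CommutativeRing 0ℓ 0ℓ
  fractionField = record { isCommutativeRing = isCommutativeRing }

  inverse-exists : ∀ p → ¬ (p ≃ embed 0#) → ∃ λ q → (q ⊗ p) ≃ embed 1#
  inverse-exists (fraction a b b≉0) p≄0 =
    fraction b a (λ a≈0 → p≄0 (cross
      (D.trans (D.*-identityʳ a) (D.trans a≈0 (D.sym (D.zeroˡ b))))))
    , cross (inverse-eq a b)

-- ℚ(x₁, …, xₘ)
ℚ⟨x⟩_ : ℕ → CommutativeRing 0ℓ 0ℓ
ℚ⟨x⟩ m = FractionField.fractionField (ℚ[x] m)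

module LinearAlgebra (R : CommutativeRing 0ℓ 0ℓ) where
  open CommutativeRing R hiding (zero)
  open RawMonoidDefs +-rawMonoid using (sum)
  open RawSemiringDefs (Semiring.rawSemiring semiring) using (_^_)

  -- Laplace expansion along the first row.
  det : ∀ {k} → (Fin k → Fin k → Carrier) → Carrier
  det {zero}  M = 1#
  det {suc k} M = sum λ j →
    ((- 1#) ^ toℕ j * M zero j) * det λ i l → M (suc i) (punchIn j l)

  module _ {I J : Set} (v : I → J → Carrier) where

    combination : List (Carrier × I) → J → Carrier
    combination []             j = 0#
    combination ((c , i) ∷ cs) j = c * v i j + combination cs j

    InSpan : Pred I 0ℓ → (J → Carrier) → Set
    InSpan P w = ∃ λ cs → All (P ∘ proj₂) cs × (∀ j → w j ≈ combination cs j)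

-- A k-subset {s₁ < … < sₖ} is the vector of its elements in increasing order;
-- the proof of monotonicity is irrelevant, so _≡_ is equality of sets.
record KSubset (n k : ℕ) : Set where
  constructor ksubset
  field
    elems       : Vec (Fin n) k
    .increasing : ∀ {i j} → i Fin.< j → lookup elems i Fin.< lookup elems j
open KSubset public

infixl 9 _!_
_!_ : ∀ {n k} → KSubset n k → Fin k → Fin n
S ! i = lookup (elems S) i

infix 4 _≤ₛ_ _⊆ₛ_

_≤ₛ_ : ∀ {n k} → Rel (KSubset n k) 0ℓ
S ≤ₛ T = ∀ i → S ! i Fin.≤ T ! i

_⊆ₛ_ : ∀ {n k l} → KSubset n k → KSubset n l → Set
S ⊆ₛ T = ∀ {x} → x Vec.∈ elems S → x Vec.∈ elems T

record IsTermOrder {n k} (_<t_ : Rel (KSubset n k) 0ℓ) : Set where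
  field
    isStrictTotalOrder : IsStrictTotalOrder _≡_ _<t_
    extends            : ∀ {S T} → S ≤ₛ T → S ≢ T → S <t T

encode : ∀ {n k} → Vec (Fin n) k → Fin (n ℕ.^ k)
encode []       = zero
encode (x ∷ xs) = combine x (encode xs)

encode-injective : ∀ {n k} (xs ys : Vec (Fin n) k) → encode xs ≡ encode ys → xs ≡ ys
encode-injective []       []       _ = refl
encode-injective (x ∷ xs) (y ∷ ys) e
  with x≡y , e′ ← combine-injective x (encode xs) y (encode ys) e
  = cong₂ _∷_ x≡y (encode-injective xs ys e′)

termOrder-wellFounded : ∀ {n k} {_<t_ : Rel (KSubset n k) 0ℓ} →
                        IsTermOrder _<t_ → WellFounded _<t_
termOrder-wellFounded {n} {k} {_<t_} termOrder =
  Subrelation.wellFounded {_<₁_ = _<t_} {_<₂_ = _⊏_ on code}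
    (λ {S} {T} S<T → S , T , refl , refl , S<T)
    (On.wellFounded code (spo-wellFounded ⊏-isStrictPartialOrder))
  where
  open IsStrictTotalOrder (IsTermOrder.isStrictTotalOrder termOrder)
    using (irrefl) renaming (trans to <t-trans)

  code : KSubset n k → Fin (n ℕ.^ k)
  code = encode ∘ elems

  code-injective : ∀ {S T} → code S ≡ code T → S ≡ T
  code-injective {ksubset xs _} {ksubset ys _} e
    with refl ← encode-injective xs ys e = refl

  _⊏_ : Rel (Fin (n ℕ.^ k)) 0ℓ
  x ⊏ y = ∃ λ S → ∃ λ T → code S ≡ x × code T ≡ y × S <t T

  ⊏-isStrictPartialOrder : IsStrictPartialOrder _≡_ _⊏_
  ⊏-isStrictPartialOrder = record
    { isEquivalence = isEquivalence
    ; irrefl = λ { refl (S , T , e , f , S<T) →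
        irrefl (code-injective (trans e (sym f))) S<T }
    ; trans = λ { (S , T , e , f , S<T) (T′ , U , e′ , f′ , T′<U) →
        S , U , e , f′ ,
        <t-trans (subst (S <t_) (code-injective (trans f (sym e′))) S<T) T′<U }
    ; <-resp-≈ = resp₂ _⊏_
    }

module _ (n : ℕ) where
  open FractionField (ℚ[x] (n ℕ.* n)) using (embed)
  open CommutativeRing (ℚ⟨x⟩ (n ℕ.* n)) using (Carrier)
  open LinearAlgebra (ℚ⟨x⟩ (n ℕ.* n)) using (det; InSpan)

  genericMatrix : Fin n → Fin n → Carrier
  genericMatrix i j = embed (var (combine i j))

  compound : ∀ k → KSubset n k → KSubset n k → Carrier
  compound k S T = det λ i j → genericMatrix (S ! i) (T ! j)

  module _ {k} (_<t_ : Rel (KSubset n k) 0ℓ) (ℱ : Pred (KSubset n k) 0ℓ) where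

    row : KSubset n k → ∃ ℱ → Carrier
    row S (T , _) = compound k S T

    -- S is selected iff its row is not in the span of the rows of the selected
    -- T <t S; the recursion is on the accessibility of S.
    Selected : (S : KSubset n k) → Acc _<t_ S → Set
    Selected S (acc rs) =
      ¬ InSpan row (λ T → Σ (T <t S) λ T<S → Selected T (rs T<S)) (row S)

    exteriorShift : IsTermOrder _<t_ → Pred (KSubset n k) 0ℓ
    exteriorShift termOrder S = Selected S (termOrder-wellFounded termOrder S)

record Graph (n : ℕ) : Set₁ where
  field
    Adj        : Rel (Fin n) 0ℓ
    adj?       : Decidable Adj
    adj-sym    : Symmetric Adj
    adj-irrefl : Irreflexive _≡_ Adj

E : ∀ {n} → Graph n → Pred (KSubset n 2) 0ℓ
E G S = Graph.Adj G (S ! zero) (S ! suc zero)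

-- For S = {a, b} ⊆ {1, …, n}: a + b. The element i of Fin n stands for i + 1.
labelSum : ∀ {n} → KSubset n 2 → ℕ
labelSum S = suc (toℕ (S ! zero)) ℕ.+ suc (toℕ (S ! suc zero))

B : ∀ n → Pred (KSubset n 2) 0ℓ
B n S = labelSum S ℕ.≤ n

{-# OPTIONS --safe #-}
module Submission where

-- Every T <ₜ S with S ∈ B(n) lies in B(n), so it suffices that the rows of the
-- compound matrix indexed by B(n), restricted to the columns E(G), are linearly
-- independent. As in Mantel's theorem, choose u, v such that every other vertex is
-- joined to u or v in G, and let Y be the matrix obtained recursively for G − {u, v}.
-- Take the first row of X to be e_u + e_v, the last row to be e_v, and the middle
-- rows to be those of Y, extended by zero to u and v. On the edges of G − {u, v} the
-- minors of the rows 1, b vanish and the others are the minors of Y for B(n − 2), and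
-- on the edges from w to u or v the minor of the rows 1, b is the entry of Y at (b, w);
-- so independence, of the rows and of the minors, passes from Y to X. Finally, Gaussian
-- elimination shows that rows which are independent after a specialisation of the
-- variables are independent.

open import Defs
open import Level using (0ℓ)
open import Algebra.Bundles using (CommutativeRing)
open import Algebra.Morphism.Structures using (module RingMorphisms)
import Algebra.Properties.Group as GroupProperties
import Algebra.Properties.Ring as RingProperties
import Algebra.Properties.Semiring.Sum as Sums
import Algebra.Solver.Ring.NaturalCoefficients.Default as NaturalCoefficients
open import Data.Empty using (⊥-elim)
open import Data.Fin using (Fin; zero; suc; toℕ; fromℕ; punchIn; punchOut;
  combine; remQuot; splitAt; join; _↑ˡ_; _↑ʳ_)
import Data.Fin as Fin
import Data.Fin.Properties as Fin
open import Data.Fin.Properties using (punchInᵢ≢i; punchIn-injective; punchIn-punchOut)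
open import Data.List using ([]; _∷_)
open import Data.List.Relation.Unary.All as All using (All; []; _∷_)
open import Data.Nat using (ℕ; zero; suc; _<_)
import Data.Nat as ℕ
import Data.Nat.Properties as ℕ
open import Data.Product using (∃; _×_; _,_; proj₁; proj₂; uncurry)
import Data.Product as Product
open import Data.Sum using (_⊎_; inj₁; inj₂; [_,_]′)
open import Data.Vec using (Vec; []; _∷_; lookup)
open import Data.Vec.Functional using (Vector; updateAt; insertAt; _++_) renaming (_∷_ to _◂_)
open import Data.Vec.Functional.Properties using (insertAt-lookup; insertAt-punchIn;
  updateAt-updates; updateAt-minimal)
open import Data.Vec.Membership.Propositional using () renaming (_∈_ to _∈ᵥ_)
open import Data.Vec.Membership.Propositional.Properties using (∈-lookup)
open import Data.Vec.Relation.Unary.Any using (here; there)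
open import Function using (_∘_; _on_)
open import Induction.WellFounded using (Acc; acc)
open import Relation.Binary using (Rel; Decidable; IsStrictTotalOrder; tri<; tri≈; tri>)
open import Relation.Binary.PropositionalEquality as ≡ using (_≡_; _≢_)
open import Relation.Nullary using (¬_; yes; no; ¬?; decidable-stable; recompute)
open import Relation.Unary using (_∈_; _⊆_)

-- Ring homomorphisms and evaluation of polynomials

module _ (R S : CommutativeRing 0ℓ 0ℓ) where
  private
    module R = CommutativeRing R
    module S = CommutativeRing S

  IsHom : (R.Carrier → S.Carrier) → Set
  IsHom = RingMorphisms.IsRingHomomorphism R.rawRing S.rawRing

  module _ (h : R.Carrier → S.Carrier) where

    -- Compatibility with negation comes for free: additive inverses in `S` are unique.
    mkIsHom : (∀ {x y} → x R.≈ y → h x S.≈ h y) →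
              (∀ x y → h (x R.+ y) S.≈ h x S.+ h y) →
              (∀ x y → h (x R.* y) S.≈ h x S.* h y) →
              h R.0# S.≈ S.0# → h R.1# S.≈ S.1# → IsHom h
    mkIsHom h-cong h-+ h-* h-0 h-1 = record
      { isSemiringHomomorphism = record
        { isNearSemiringHomomorphism = record
          { +-isMonoidHomomorphism = record
            { isMagmaHomomorphism = record
              { isRelHomomorphism = record { cong = h-cong }
              ; homo = h-+
              }
            ; ε-homo = h-0
            }
          ; *-homo = h-*
          }
        ; 1#-homo = h-1
        }
      ; -‿homo = λ x → GroupProperties.inverseˡ-unique S.+-group _ _
          (S.trans (S.sym (h-+ (R.- x) x)) (S.trans (h-cong (R.-‿inverseˡ x)) h-0))
      }

module Evaluation (R S : CommutativeRing 0ℓ 0ℓ) where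
  private
    module R = CommutativeRing R
    open CommutativeRing S
    open Polynomial R
    open NaturalCoefficients commutativeSemiring using (solve; _:=_; _:+_; _:*_)

  module _ {h : R.Carrier → Carrier} (h-hom : IsHom R S h) (a : Carrier) where
    private module h = RingMorphisms.IsRingHomomorphism h-hom

    eval : Poly → Carrier
    eval []      = 0#
    eval (r ∷ p) = h r + a * eval p

    private
      eval-∷ : ∀ {x y} → x ≈ 0# → y ≈ 0# → x + a * y ≈ 0#
      eval-∷ e f = trans (+-cong e (trans (*-congˡ f) (zeroʳ a))) (+-identityˡ 0#)

    -- `_≈ₚ_` ignores trailing zeros, so a list of any length may equal `0ₚ`; `eval-cong` falls back
    -- on this when one of its two lists runs out.
    eval-≈0 : ∀ {p} → p ≈ₚ 0ₚ → eval p ≈ 0#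
    eval-≈0 {[]}    e = refl
    eval-≈0 {r ∷ p} e =
      eval-∷ (trans (h.⟦⟧-cong (at e 0)) h.0#-homo) (eval-≈0 (tail≈0 e))

    eval-cong : ∀ {p q} → p ≈ₚ q → eval p ≈ eval q
    eval-cong {[]}            e = sym (eval-≈0 (≈ₚ-sym e))
    eval-cong {_ ∷ _} {[]}    e = eval-≈0 e
    eval-cong {_ ∷ _} {_ ∷ _} e =
      +-cong (h.⟦⟧-cong (at e 0)) (*-congˡ (eval-cong (tail-≈ e)))

    eval-+ : ∀ p q → eval (p +ₚ q) ≈ eval p + eval q
    eval-+ []      q       = sym (+-identityˡ _)
    eval-+ (r ∷ p) []      = sym (+-identityʳ _)
    eval-+ (r ∷ p) (s ∷ q) =
      trans (+-cong (h.+-homo r s) (*-congˡ (eval-+ p q)))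
            (solve 5 (λ x y a P Q → (x :+ y) :+ a :* (P :+ Q)
                                 := (x :+ a :* P) :+ (y :+ a :* Q))
                   refl (h r) (h s) a (eval p) (eval q))

    eval-· : ∀ r p → eval (r · p) ≈ h r * eval p
    eval-· r []      = sym (zeroʳ (h r))
    eval-· r (s ∷ p) =
      trans (+-cong (h.*-homo r s) (*-congˡ (eval-· r p)))
            (solve 4 (λ x y a P → x :* y :+ a :* (x :* P) := x :* (y :+ a :* P))
                   refl (h r) (h s) a (eval p))

    eval-* : ∀ p q → eval (p *ₚ q) ≈ eval p * eval q
    eval-* []      q = sym (zeroˡ (eval q))
    eval-* (r ∷ p) q =
      trans (eval-+ (r · q) (R.0# ∷ p *ₚ q))
      (trans (+-cong (eval-· r q)
               (trans (+-cong h.0#-homo (*-congˡ (eval-* p q))) (+-identityˡ _)))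
             (solve 4 (λ x a P Q → x :* Q :+ a :* (P :* Q) := (x :+ a :* P) :* Q)
                    refl (h r) a (eval p) (eval q)))

    eval-constant : ∀ r → eval (r ∷ []) ≈ h r
    eval-constant r = trans (+-congˡ (zeroʳ a)) (+-identityʳ (h r))

    eval-isHom : IsHom polynomialRing S eval
    eval-isHom = mkIsHom polynomialRing S eval eval-cong eval-+ eval-* refl
      (trans (eval-constant R.1#) h.1#-homo)

    eval-variable : eval (R.0# ∷ R.1# ∷ []) ≈ a
    eval-variable = trans (+-cong h.0#-homo (*-congˡ (trans (eval-constant R.1#) h.1#-homo)))
                          (trans (+-identityˡ _) (*-identityʳ a))

private module ℚ = IntegralDomain ℚ-domain

-- The polynomial ring is iterated: the evaluation of the coefficients at `a ∘ suc` is extended by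
-- sending the outermost variable to `a zero`.
evaluation : ∀ {m} → (Fin m → ℚ.Carrier) →
  ∃ (IsHom (IntegralDomain.commutativeRing (ℚ[x] m)) ℚ.commutativeRing)
evaluation {zero}  a = (λ x → x) , mkIsHom ℚ.commutativeRing ℚ.commutativeRing _
  (λ e → e) (λ _ _ → ≡.refl) (λ _ _ → ≡.refl) ≡.refl ≡.refl
evaluation {suc m} a = _ , eval-isHom (proj₂ (evaluation (a ∘ suc))) (a zero)
  where open Evaluation (IntegralDomain.commutativeRing (ℚ[x] m)) ℚ.commutativeRing

evaluation-var : ∀ {m} (a : Fin m → ℚ.Carrier) i → proj₁ (evaluation a) (var i) ≡ a i
evaluation-var {suc m} a zero = eval-variable (proj₂ (evaluation (a ∘ suc))) (a zero)
  where open Evaluation (IntegralDomain.commutativeRing (ℚ[x] m)) ℚ.commutativeRing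
evaluation-var {suc m} a (suc i) = ≡.trans
  (eval-constant (proj₂ (evaluation (a ∘ suc))) (a zero) (var i)) (evaluation-var (a ∘ suc) i)
  where open Evaluation (IntegralDomain.commutativeRing (ℚ[x] m)) ℚ.commutativeRing

-- Embedding a domain into its field of fractions

module Embedding (D : IntegralDomain) where
  open FractionField D
  private
    module D = IntegralDomain D
    module K = CommutativeRing fractionField
    open NaturalCoefficients D.commutativeSemiring using (solve; _:=_; _:+_; _:*_; con)

  embed-isHom : IsHom D.commutativeRing fractionField embed
  embed-isHom = mkIsHom D.commutativeRing fractionField embed
    (λ e → cross (D.*-congʳ e))
    (λ x y → cross (solve 2 (λ x y → (x :+ y) :* (con 1 :* con 1)
                                  := (x :* con 1 :+ y :* con 1) :* con 1) D.refl x y))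
    (λ x y → cross (solve 2 (λ x y → (x :* y) :* (con 1 :* con 1)
                                  := (x :* y) :* con 1) D.refl x y))
    K.refl K.refl

  ≃0⇒num≈0 : ∀ {p} → p ≃ embed D.0# → num p D.≈ D.0#
  ≃0⇒num≈0 {p} (cross e) = D.trans (D.sym (D.*-identityʳ (num p))) (D.trans e (D.zeroˡ (den p)))

  num≈0⇒≃0 : ∀ {p} → num p D.≈ D.0# → p ≃ embed D.0#
  num≈0⇒≃0 {p} e = cross (D.trans (D.*-identityʳ (num p)) (D.trans e (D.sym (D.zeroˡ (den p)))))

  -- Vanishing is decided on the numerator. This later discharges the double negation under which a
  -- pivot is found.
  ≃0-stable : ∀ {p} → ¬ ¬ (p ≃ embed D.0#) → p ≃ embed D.0#
  ≃0-stable {p} ¬¬e with num p D.≟ D.0#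
  ... | yes e = num≈0⇒≃0 e
  ... | no ¬e = ⊥-elim (¬¬e (¬e ∘ ≃0⇒num≈0))

  embed-torsionFree : ∀ x p → ¬ (x D.≈ D.0#) → embed x ⊗ p ≃ embed D.0# → p ≃ embed D.0#
  embed-torsionFree x p x≉0 e with D.noZeroDivisors x (num p) (≃0⇒num≈0 e)
  ... | inj₁ x≈0 = ⊥-elim (x≉0 x≈0)
  ... | inj₂ y≈0 = num≈0⇒≃0 y≈0

  1≄0 : ¬ (embed D.1# ≃ embed D.0#)
  1≄0 e = D.1≉0 (≃0⇒num≈0 e)

-- Linear independence of finite families of rows

module Independence (R : CommutativeRing 0ℓ 0ℓ) where
  open CommutativeRing R hiding (zero)
  open Sums semiring using (sum; sum-cong-≋; ∑-distrib-+; *-distribˡ-sum; sum-replicate-zero)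
  open LinearAlgebra R using (combination)
  open RingProperties ring using (-‿distribˡ-*; -‿involutive; -0#≈0#)
  open NaturalCoefficients commutativeSemiring using (solve; _:=_; _:+_; _:*_)

  module _ {J : Set} where

    infixl 7 _∙_
    _∙_ : ∀ {N} → Vector Carrier N → Vector (J → Carrier) N → J → Carrier
    (c ∙ v) j = sum λ k → c k * v k j

    Independent : ∀ {N} → Vector (J → Carrier) N → Set
    Independent v = ∀ c → (∀ j → (c ∙ v) j ≈ 0#) → ∀ k → c k ≈ 0#

  sum-≈0 : ∀ {N} {t : Vector Carrier N} → (∀ k → t k ≈ 0#) → sum t ≈ 0#
  sum-≈0 {N} e = trans (sum-cong-≋ e) (sum-replicate-zero N)

  -- The column sets `J` and `J′` may differ: rows on the edges of a graph will be compared with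
  -- rows on the edges of an induced subgraph.
  ∙-congʳ : ∀ {N J J′} (c : Vector Carrier N) (v : Vector (J → Carrier) N) j
           (w : Vector (J′ → Carrier) N) j′ → (∀ k → v k j ≈ w k j′) → (c ∙ v) j ≈ (c ∙ w) j′
  ∙-congʳ c v j w j′ e = sum-cong-≋ λ k → *-congˡ (e k)

  ∙-≈0ˡ : ∀ {N J} {c : Vector Carrier N} (v : Vector (J → Carrier) N) j →
         (∀ k → c k ≈ 0#) → (c ∙ v) j ≈ 0#
  ∙-≈0ˡ v j e = sum-≈0 λ k → trans (*-congʳ (e k)) (zeroˡ _)

  ∙-≈0ʳ : ∀ {N J} (c : Vector Carrier N) (v : Vector (J → Carrier) N) j →
         (∀ k → v k j ≈ 0#) → (c ∙ v) j ≈ 0#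
  ∙-≈0ʳ c v j e = sum-≈0 λ k → trans (*-congˡ (e k)) (zeroʳ _)

  ∙-bilinear : ∀ {N J} (c : Vector Carrier N) (v : Vector (J → Carrier) N) x y {i j} →
    sum (λ k → c k * (x * v k i + y * v k j)) ≈ x * (c ∙ v) i + y * (c ∙ v) j
  ∙-bilinear c v x y {i} {j} = trans
    (sum-cong-≋ λ k → solve 5 (λ c x y a b →
       c :* (x :* a :+ y :* b) := x :* (c :* a) :+ y :* (c :* b)) refl (c k) x y (v k i) (v k j))
    (trans (∑-distrib-+ (λ k → x * (c k * v k i)) (λ k → y * (c k * v k j)))
           (sym (+-cong (*-distribˡ-sum x (λ k → c k * v k i))
                        (*-distribˡ-sum y (λ k → c k * v k j)))))

  ∙-antisymmetric : ∀ {N J} (c : Vector Carrier N) (v : Vector (J → Carrier) N) i j →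
    (∀ k → v k i + v k j ≈ 0#) → (c ∙ v) j ≈ 0# → (c ∙ v) i ≈ 0#
  ∙-antisymmetric c v i j e cvj≈0 = trans (sym (trans (+-congˡ cvj≈0) (+-identityʳ _)))
    (trans (sym (∑-distrib-+ (λ k → c k * v k i) (λ k → c k * v k j)))
           (sum-≈0 λ k → trans (sym (distribˡ _ _ _)) (trans (*-congˡ (e k)) (zeroʳ _))))

  ∙-++ : ∀ {M N J} (c : Vector Carrier (M ℕ.+ N)) (v : Vector (J → Carrier) M)
         (w : Vector (J → Carrier) N) j →
         (c ∙ (v ++ w)) j ≈ ((c ∘ (_↑ˡ N)) ∙ v) j + ((c ∘ (M ↑ʳ_)) ∙ w) j
  ∙-++ {zero}  c v w j = sym (+-identityˡ _)
  ∙-++ {suc M} {N} c v w j = trans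
    (+-congˡ (trans (∙-congʳ (c ∘ suc) ((v ++ w) ∘ suc) j ((v ∘ suc) ++ w) j
                      (λ k → reflexive (≡.cong (λ f → f j) (++-suc k))))
                    (∙-++ (c ∘ suc) (v ∘ suc) w j)))
    (sym (+-assoc _ _ _))
    where
    ++-suc : ∀ k → (v ++ w) (suc k) ≡ ((v ∘ suc) ++ w) k
    ++-suc k with splitAt M k
    ... | inj₁ _ = ≡.refl
    ... | inj₂ _ = ≡.refl

  add : ∀ {N} → Carrier → Fin N → Vector Carrier N → Vector Carrier N
  add x k c = updateAt c k (x +_)

  ∙-add : ∀ {N J} x k (c : Vector Carrier N) (v : Vector (J → Carrier) N) j →
          (add x k c ∙ v) j ≈ x * v k j + (c ∙ v) j
  ∙-add x zero    c v j = trans (+-congʳ (distribʳ _ x _)) (+-assoc _ _ _)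
  ∙-add x (suc k) c v j = trans (+-congˡ (∙-add x k (c ∘ suc) (v ∘ suc) j))
    (solve 3 (λ a b c → a :+ (b :+ c) := b :+ (a :+ c)) refl _ _ _)

  module _ {I J : Set} (v : I → J → Carrier) {N} (f : Fin N → I) (k₀ : Fin N) where

    IndexedAwayFrom : I → Set
    IndexedAwayFrom i = ∃ λ k → f k ≡ i × k₀ ≢ k

    -- The list in `InSpan` may mention a row repeatedly; its coefficients are added up index by
    -- index. The result is zero at `k₀` because every entry has an index other than `k₀`.
    collect : ∀ cs → All (IndexedAwayFrom ∘ proj₂) cs →
      ∃ λ c → c k₀ ≈ 0# × (∀ j → combination v cs j ≈ (c ∙ (v ∘ f)) j)
    collect [] [] = (λ _ → 0#) , refl , λ j → sym (∙-≈0ˡ (v ∘ f) j (λ _ → refl))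
    collect ((x , .(f k)) ∷ cs) ((k , ≡.refl , k₀≢k) ∷ ps)
      with c , c≈0 , e ← collect cs ps
      = add x k c
      , trans (reflexive (updateAt-minimal k₀ k c k₀≢k)) c≈0
      , λ j → trans (+-congˡ (e j)) (sym (∙-add x k c (v ∘ f) j))

    -- Subtracting row `k₀` from the combination gives a relation whose coefficient at `k₀` is -1;
    -- independence would make -1, hence 1, vanish.
    independent⇒∉span : ¬ (1# ≈ 0#) → Independent (v ∘ f) → ∀ cs →
      All (IndexedAwayFrom ∘ proj₂) cs → ¬ (∀ j → v (f k₀) j ≈ combination v cs j)
    independent⇒∉span 1≉0 ind cs ps e with c , c≈0 , e′ ← collect cs ps =
      1≉0 (trans (sym (-‿involutive 1#)) (trans (-‿cong -1≈0) -0#≈0#))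
      where
      d = add (- 1#) k₀ c
      -1≈0 : - 1# ≈ 0#
      -1≈0 = trans (sym (+-identityʳ _))
             (trans (+-congˡ (sym c≈0))
             (trans (sym (reflexive (updateAt-updates k₀ c)))
             (ind d (λ j → trans (∙-add (- 1#) k₀ c (v ∘ f) j)
               (trans (+-cong (trans (sym (-‿distribˡ-* 1# _)) (-‿cong (*-identityˡ _)))
                              (trans (sym (e′ j)) (sym (e j))))
                      (-‿inverseˡ _))) k₀)))

-- Gaussian elimination: independence under `φ` implies independence under `ι`

module Transfer (D : CommutativeRing 0ℓ 0ℓ) (F : IntegralDomain) (K : CommutativeRing 0ℓ 0ℓ) where
  private
    module D = CommutativeRing D
    module F = IntegralDomain F
    module K = CommutativeRing K
    module IF = Independence F.commutativeRing
    module IK = Independence K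

  -- Fraction-free elimination in column `p`: multiplying by the pivot instead of dividing keeps the
  -- entries in `D`, where both `φ` and `ι` apply.
  eliminate : ∀ {N} {J : Set} → J → Vector (J → D.Carrier) (suc N) → Vector (J → D.Carrier) N
  eliminate p v k j = v zero p D.* v (suc k) j D.+ D.- v zero j D.* v (suc k) p

  module _ (S : CommutativeRing 0ℓ 0ℓ)
           {h : D.Carrier → CommutativeRing.Carrier S} (h-hom : IsHom D S h) where
    open CommutativeRing S hiding (zero)
    open Independence S
    private module h = RingMorphisms.IsRingHomomorphism h-hom

    ∙-eliminate : ∀ {N} {J : Set} p (v : Vector (J → D.Carrier) (suc N)) c j →
      (c ∙ (λ k j → h (eliminate p v k j))) j ≈
      h (v zero p) * (c ∙ (λ k j → h (v (suc k) j))) j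
        + - h (v zero j) * (c ∙ (λ k j → h (v (suc k) j))) p
    ∙-eliminate p v c j = trans
      (∙-congʳ c (λ k j → h (eliminate p v k j)) j
        (λ k j → h (v zero p) * h (v (suc k) j) + - h (v zero j) * h (v (suc k) p)) j
        λ k → trans (h.+-homo _ _)
          (+-cong (h.*-homo _ _) (trans (h.*-homo _ _) (*-congʳ (h.-‿homo _)))))
      (∙-bilinear c (λ k j → h (v (suc k) j)) (h (v zero p)) (- h (v zero j)))

  module _ {φ : D.Carrier → F.Carrier} (φ-hom : IsHom D F.commutativeRing φ)
           {ι : D.Carrier → K.Carrier} (ι-hom : IsHom D K ι)
           (stable : ∀ x → ¬ ¬ (x K.≈ K.0#) → x K.≈ K.0#)
           (torsionFree : ∀ x y → ¬ (φ x F.≈ F.0#) → ι x K.* y K.≈ K.0# → y K.≈ K.0#) where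

    -- If the image of the first row were zero, the coefficients 1, 0, ..., 0 would be a relation.
    -- The type `J` cannot be searched, so existence is only doubly negated.
    pivot : ∀ {N} {J : Set} (v : Vector (J → D.Carrier) (suc N)) →
            IF.Independent (λ k j → φ (v k j)) → ¬ ¬ (∃ λ p → ¬ (φ (v zero p) F.≈ F.0#))
    pivot v ind no-pivot = F.1≉0 (ind (F.1# ◂ λ _ → F.0#) (λ j →
      F.trans (F.+-cong (F.trans (F.*-identityˡ _) (vanish j))
                        (IF.∙-≈0ˡ (λ k j → φ (v (suc k) j)) j (λ _ → F.refl)))
              (F.+-identityˡ F.0#)) zero)
      where
      vanish : ∀ j → φ (v zero j) F.≈ F.0#
      vanish j with φ (v zero j) F.≟ F.0#
      ... | yes e = e
      ... | no ¬e = ⊥-elim (no-pivot (j , ¬e))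

    -- A relation `d` among the eliminated rows pulls back to one among the original rows, with
    -- coefficient `P * d k` at row `k + 1`; cancelling the nonzero `P` gives `d k` = 0.
    eliminate-independent : ∀ {N} {J : Set} p (v : Vector (J → D.Carrier) (suc N)) →
      ¬ (φ (v zero p) F.≈ F.0#) → IF.Independent (λ k j → φ (v k j)) →
      IF.Independent (λ k j → φ (eliminate p v k j))
    eliminate-independent p v vp≉0 ind d e k =
      [ ⊥-elim ∘ vp≉0 , (λ dk≈0 → dk≈0) ]′ (F.noZeroDivisors _ _ (ind c relation (suc k)))
      where
      open import Relation.Binary.Reasoning.Setoid F.setoid
      open RingProperties F.ring using (-‿distribˡ-*; -‿distribʳ-*)
      w : Vector _ _
      w k j = φ (v (suc k) j)
      P = φ (v zero p)
      c = (F.- (d IF.∙ w) p) ◂ λ k → P F.* d k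
      relation : ∀ j → (c IF.∙ λ k j → φ (v k j)) j F.≈ F.0#
      relation j = begin
        (F.- (d IF.∙ w) p) F.* φ (v zero j) F.+ ((λ k → P F.* d k) IF.∙ w) j
          ≈⟨ F.+-cong (F.trans (F.sym (-‿distribˡ-* _ _))
                      (F.trans (F.-‿cong (F.*-comm _ _)) (-‿distribˡ-* _ _)))
                      (F.trans (sum-cong λ k → F.*-assoc P (d k) (w k j))
                      (F.sym (distr P (λ k → d k F.* w k j)))) ⟩
        (F.- φ (v zero j)) F.* (d IF.∙ w) p F.+ P F.* (d IF.∙ w) j
          ≈⟨ F.+-comm _ _ ⟩
        P F.* (d IF.∙ w) j F.+ (F.- φ (v zero j)) F.* (d IF.∙ w) p
          ≈⟨ ∙-eliminate F.commutativeRing φ-hom p v d j ⟨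
        (d IF.∙ λ k j → φ (eliminate p v k j)) j
          ≈⟨ e j ⟩
        F.0# ∎
        where open Sums F.semiring using () renaming (sum-cong-≋ to sum-cong; *-distribˡ-sum to distr)

    -- Induction on the number of rows. A relation `c` over `K` yields one among the eliminated
    -- rows, so its tail vanishes; column `p` then says that `P` times `c zero` is 0. The conclusion
    -- is `stable`, so a doubly negated pivot suffices.
    transfer : ∀ {N} {J : Set} (v : Vector (J → D.Carrier) N) →
               IF.Independent (λ k j → φ (v k j)) → IK.Independent (λ k j → ι (v k j))
    transfer {zero}  v ind c e ()
    transfer {suc N} v ind c e k = stable (c k) λ ck≉0 → pivot v ind λ (p , vp≉0) →
      ck≉0 (all p vp≉0 k)
      where
      open import Relation.Binary.Reasoning.Setoid K.setoid
      open NaturalCoefficients K.commutativeSemiring using (solve; _:=_; _:+_; _:*_)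
      w : Vector _ N
      w k j = ι (v (suc k) j)
      module _ (p : _) (vp≉0 : ¬ (φ (v zero p) F.≈ F.0#)) where
        P = ι (v zero p)
        relation : ∀ j → ((c ∘ suc) IK.∙ λ k j → ι (eliminate p v k j)) j K.≈ K.0#
        relation j = begin
          ((c ∘ suc) IK.∙ λ k j → ι (eliminate p v k j)) j
            ≈⟨ ∙-eliminate K ι-hom p v (c ∘ suc) j ⟩
          P K.* Aⱼ K.+ Q′ K.* Aⱼ₀
            ≈⟨ K.+-identityˡ _ ⟨
          K.0# K.+ (P K.* Aⱼ K.+ Q′ K.* Aⱼ₀)
            -- The inserted zero (Q - Q) · P · `c zero` completes the two sums to the relations in
            -- columns `j` and `p`, multiplied by P and -Q.
            ≈⟨ K.+-congʳ (K.trans (K.*-congʳ (K.-‿inverseʳ Q)) (K.zeroˡ (P K.* c zero))) ⟨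
          (Q K.+ Q′) K.* (P K.* c zero) K.+ (P K.* Aⱼ K.+ Q′ K.* Aⱼ₀)
            ≈⟨ solve 6 (λ P Q Q′ Aⱼ Aⱼ₀ c → (Q :+ Q′) :* (P :* c) :+ (P :* Aⱼ :+ Q′ :* Aⱼ₀)
                 := P :* (c :* Q :+ Aⱼ) :+ Q′ :* (c :* P :+ Aⱼ₀)) K.refl P Q Q′ Aⱼ Aⱼ₀ (c zero) ⟩
          P K.* (c zero K.* Q K.+ Aⱼ) K.+ Q′ K.* (c zero K.* P K.+ Aⱼ₀)
            ≈⟨ K.+-cong (K.trans (K.*-congˡ (e j)) (K.zeroʳ P))
                        (K.trans (K.*-congˡ (e p)) (K.zeroʳ Q′)) ⟩
          K.0# K.+ K.0#
            ≈⟨ K.+-identityˡ K.0# ⟩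
          K.0# ∎
          where
          Q = ι (v zero j)
          Q′ = K.- Q
          Aⱼ = ((c ∘ suc) IK.∙ w) j
          Aⱼ₀ = ((c ∘ suc) IK.∙ w) p
        tail : ∀ k → c (suc k) K.≈ K.0#
        tail = transfer (eliminate p v) (eliminate-independent p v vp≉0 ind) (c ∘ suc) relation
        head : P K.* c zero K.≈ K.0#
        head = begin
          P K.* c zero                           ≈⟨ K.*-comm P (c zero) ⟩
          c zero K.* P                           ≈⟨ K.+-identityʳ _ ⟨
          c zero K.* P K.+ K.0#                  ≈⟨ K.+-congˡ (IK.∙-≈0ˡ w p tail) ⟨
          c zero K.* P K.+ ((c ∘ suc) IK.∙ w) p  ≈⟨ e p ⟩
          K.0# ∎
        all : ∀ k → c k K.≈ K.0#
        all zero    = torsionFree (v zero p) (c zero) vp≉0 head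
        all (suc k) = tail k

-- Graphs with triangle-free complement

Mantelian : ∀ {n} → Rel (Fin n) 0ℓ → Set
Mantelian Adj = ∀ i j k → i ≢ j → j ≢ k → i ≢ k → Adj i j ⊎ Adj j k ⊎ Adj i k

-- `v` is an index among the vertices other than `u`, so `u` and `punchIn u v` are distinct by
-- construction.
outside : ∀ {m} → Fin (2 ℕ.+ m) → Fin (1 ℕ.+ m) → Fin m → Fin (2 ℕ.+ m)
outside u v w = punchIn u (punchIn v w)

outside-injective : ∀ {m} u v {i j : Fin m} → outside u v i ≡ outside u v j → i ≡ j
outside-injective u v = punchIn-injective v _ _ ∘ punchIn-injective u _ _

-- For a non-adjacent pair, the edge that the hypothesis provides among the pair and `w` must end in
-- `w`.
dominatingPair : ∀ {m} (Adj : Rel (Fin (2 ℕ.+ m)) 0ℓ) → Decidable Adj → Mantelian Adj →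
  ∃ λ u → ∃ λ v → ∀ w → Adj u (outside u v w) ⊎ Adj (punchIn u v) (outside u v w)
dominatingPair Adj adj? mantelian
  with Fin.any? (λ u → Fin.any? λ v → ¬? (adj? u (punchIn u v)))
-- Every two vertices are adjacent, so any pair will do; 0 and 1 are taken.
... | no ¬nonedge = zero , zero , λ w →
  inj₁ (decidable-stable (adj? zero (suc (suc w))) λ ¬a → ¬nonedge (zero , suc w , ¬a))
... | yes (u , v , ¬a) = u , v , λ w →
  [ ⊥-elim ∘ ¬a , [ inj₂ , inj₁ ]′ ]′
  (mantelian u (punchIn u v) (outside u v w) (punchInᵢ≢i u _ ∘ ≡.sym)
    (punchInᵢ≢i v w ∘ ≡.sym ∘ punchIn-injective u _ _) (punchInᵢ≢i u _ ∘ ≡.sym))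

-- Enumeration of B(n), and 2 × 2 minors

inner : ∀ {m} → Fin m → Fin (2 ℕ.+ m)
inner {m} a = suc (punchIn (fromℕ m) a)

size : ℕ → ℕ
size (suc (suc m)) = m ℕ.+ size m
size _             = 0

-- An enumeration of B(n): the pairs {1, b} with 1 < b < n, followed by B(n − 2) shifted by one.
pair : ∀ n → Fin (size n) → Fin n × Fin n
pair (suc (suc m)) = (λ b → zero , inner b) ++ (λ k → Product.map inner inner (pair m k))

-- Edges are ordered pairs, so they need not be sorted when their ends are written as `u`,
-- `punchIn u v` or `outside u v w`.
Edge : ∀ {n} → Rel (Fin n) 0ℓ → Set
Edge Adj = ∃ λ e → Adj (proj₁ e) (proj₂ e)

members : ∀ {n} → KSubset n 2 → Fin n × Fin n
members S = S ! zero , S ! suc zero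

module _ (R : CommutativeRing 0ℓ 0ℓ) where
  open CommutativeRing R hiding (zero)
  open RingProperties ring using (-1*x≈-x)
  open NaturalCoefficients commutativeSemiring using (solve; _:=_; _:+_; _:*_; con)

  minor : ∀ {n} → (Fin n → Fin n → Carrier) → Fin n × Fin n → Fin n × Fin n → Carrier
  minor X (a , b) (i , j) = X a i * X b j + - (X a j * X b i)

  minor-antisymmetric : ∀ {n} (X : Fin n → Fin n → Carrier) p i j →
                        minor X p (i , j) + minor X p (j , i) ≈ 0#
  minor-antisymmetric X (a , b) i j = trans
    (solve 4 (λ x y x′ y′ → (x :+ y′) :+ (y :+ x′) := (x :+ x′) :+ (y :+ y′)) refl
       (X a i * X b j) (X a j * X b i) (- (X a i * X b j)) (- (X a j * X b i)))
    (trans (+-cong (-‿inverseʳ _) (-‿inverseʳ _)) (+-identityˡ 0#))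

  open LinearAlgebra R using (det)

  det-minor : ∀ {n} (X : Fin n → Fin n → Carrier) (S T : KSubset n 2) →
    det (λ i j → X (S ! i) (T ! j)) ≈ minor X (members S) (members T)
  det-minor X S T = trans
    -- The semiring solver has no negation, so the -1 of the Laplace expansion enters as an unknown
    -- `n`.
    (solve 5 (λ a b c d n →
      ((con 1 :* a) :* ((con 1 :* d) :* con 1 :+ con 0))
        :+ (((n :* con 1) :* b) :* ((con 1 :* c) :* con 1 :+ con 0) :+ con 0)
      := a :* d :+ n :* (b :* c)) refl _ _ _ _ (- 1#))
    (+-congˡ (-1*x≈-x _))

module _ (R S : CommutativeRing 0ℓ 0ℓ) where
  private
    module R = CommutativeRing R
  open CommutativeRing S

  hom-minor : ∀ {n} {h} → IsHom R S h → ∀ (X : Fin n → Fin n → R.Carrier) p q →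
              h (minor R X p q) ≈ minor S (λ i j → h (X i j)) p q
  hom-minor h-hom X p q = trans (h.+-homo _ _)
    (+-cong (h.*-homo _ _) (trans (h.-‿homo _) (-‿cong (h.*-homo _ _))))
    where module h = RingMorphisms.IsRingHomomorphism h-hom

-- The recursive specialisation of the matrix

module Specialisation (R : CommutativeRing 0ℓ 0ℓ) where
  open CommutativeRing R hiding (zero)
  open Independence R
  open Sums semiring using (sum-remove)
  open RingProperties ring using (-0#≈0#)

  minorRows : ∀ {n} (Adj : Rel (Fin n) 0ℓ) → (Fin n → Fin n → Carrier) →
              Vector (Edge Adj → Carrier) (size n)
  minorRows {n} Adj X k (e , _) = minor R X (pair n k) e

  module Step {m} (u : Fin (2 ℕ.+ m)) (v : Fin (1 ℕ.+ m)) (Y : Fin m → Fin m → Carrier) where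

    v′ last : Fin (2 ℕ.+ m)
    v′ = punchIn u v
    last = suc (fromℕ m)

    spread : Carrier → Carrier → Vector Carrier m → Vector Carrier (2 ℕ.+ m)
    spread x y r = insertAt (insertAt r v y) u x

    X : Fin (2 ℕ.+ m) → Fin (2 ℕ.+ m) → Carrier
    X = spread 1# 1# (λ _ → 0#) ◂
        insertAt (λ a → spread 0# 0# (Y a)) (fromℕ m) (spread 0# 1# (λ _ → 0#))

    spread-u : ∀ x y r → spread x y r u ≡ x
    spread-u x y r = insertAt-lookup _ u x

    spread-v : ∀ x y r → spread x y r v′ ≡ y
    spread-v x y r = ≡.trans (insertAt-punchIn _ u x v) (insertAt-lookup r v y)

    spread-outside : ∀ x y r w → spread x y r (outside u v w) ≡ r w
    spread-outside x y r w = ≡.trans (insertAt-punchIn _ u x _) (insertAt-punchIn r v y w)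

    X-inner : ∀ a i → X (inner a) i ≡ spread 0# 0# (Y a) i
    X-inner a i = ≡.cong (λ f → f i) (insertAt-punchIn (λ a → spread 0# 0# (Y a)) (fromℕ m) _ a)

    X-last : ∀ i → X last i ≡ spread 0# 1# (λ _ → 0#) i
    X-last i = ≡.cong (λ f → f i)
      (insertAt-lookup (λ a → spread 0# 0# (Y a)) (fromℕ m) (spread 0# 1# (λ _ → 0#)))

    X-inner-outside : ∀ a w → X (inner a) (outside u v w) ≈ Y a w
    X-inner-outside a w = reflexive (≡.trans (X-inner a _) (spread-outside _ _ _ w))

    X-zero-outside : ∀ w → X zero (outside u v w) ≈ 0#
    X-zero-outside w = reflexive (spread-outside _ _ _ w)

    X-inner-u : ∀ a → X (inner a) u ≈ 0#
    X-inner-u a = reflexive (≡.trans (X-inner a u) (spread-u _ _ _))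

    X-inner-v : ∀ a → X (inner a) v′ ≈ 0#
    X-inner-v a = reflexive (≡.trans (X-inner a v′) (spread-v _ _ _))

    X-last-u : X last u ≈ 0#
    X-last-u = reflexive (≡.trans (X-last u) (spread-u 0# 1# _))

    X-last-v : X last v′ ≈ 1#
    X-last-v = reflexive (≡.trans (X-last v′) (spread-v 0# 1# _))

    minor-outside : ∀ k i j →
      minor R X (Product.map inner inner (pair m k)) (outside u v i , outside u v j)
        ≈ minor R Y (pair m k) (i , j)
    minor-outside k i j = +-cong (*-cong (X-inner-outside _ i) (X-inner-outside _ j))
                                 (-‿cong (*-cong (X-inner-outside _ j) (X-inner-outside _ i)))

    minor-zero-outside : ∀ b i j → minor R X (zero , inner b) (outside u v i , outside u v j) ≈ 0#
    minor-zero-outside b i j = trans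
      (+-cong (trans (*-congʳ (X-zero-outside i)) (zeroˡ _))
              (-‿cong (trans (*-congʳ (X-zero-outside j)) (zeroˡ _))))
      (-‿inverseʳ 0#)

    -- Stated for any `x` where the first row is 1, so that it serves for both `u` and `v′`,
    -- whichever is joined to `w`.
    minor-pivot : ∀ {x} → X zero x ≈ 1# → ∀ b w →
      minor R X (zero , inner b) (x , outside u v w) ≈ Y b w
    minor-pivot e b w = trans
      (+-cong (trans (*-cong e (X-inner-outside b w)) (*-identityˡ _))
              (trans (-‿cong (trans (*-congʳ (X-zero-outside w)) (zeroˡ _))) -0#≈0#))
      (+-identityʳ _)

    -- Among all rows only the first is nonzero at `u`, so `c zero` vanishes; among the others only
    -- the last is nonzero at `v′`; the remaining columns leave a relation among the rows of `Y`.
    X-independent : Independent Y → Independent X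
    X-independent ind c e = λ
      { zero → c₀≈0
      ; (suc k) → tail k }
      where
      d = c ∘ inner
      split : ∀ i → c zero * X zero i + (c last * X last i + (d ∙ (X ∘ inner)) i) ≈ 0#
      split i = trans
        (+-congˡ (sym (sum-remove {i = fromℕ m} (λ k → c (suc k) * X (suc k) i)))) (e i)
      c₀≈0 : c zero ≈ 0#
      c₀≈0 = trans (sym (trans
        (+-cong (trans (*-congˡ (reflexive (spread-u _ _ _))) (*-identityʳ _))
          (trans (+-cong (trans (*-congˡ (X-last-u)) (zeroʳ _))
                         (∙-≈0ʳ d (X ∘ inner) u X-inner-u))
                 (+-identityˡ 0#)))
        (+-identityʳ _))) (split u)
      split′ : ∀ i → c last * X last i + (d ∙ (X ∘ inner)) i ≈ 0#
      split′ i = trans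
        (sym (trans (+-congʳ (trans (*-congʳ c₀≈0) (zeroˡ _))) (+-identityˡ _))) (split i)
      cₗ≈0 : c last ≈ 0#
      cₗ≈0 = trans (sym (trans
        (+-cong (trans (*-congˡ (X-last-v)) (*-identityʳ _))
                (∙-≈0ʳ d (X ∘ inner) v′ X-inner-v))
        (+-identityʳ _))) (split′ v′)
      d≈0 : ∀ a → d a ≈ 0#
      d≈0 = ind d λ w → trans
        (∙-congʳ d Y w (X ∘ inner) (outside u v w) (λ a → sym (X-inner-outside a w)))
        (trans (sym (trans (+-congʳ (trans (*-congʳ cₗ≈0) (zeroˡ _))) (+-identityˡ _)))
               (split′ (outside u v w)))
      tail : ∀ k → c (suc k) ≈ 0#
      tail k with fromℕ m Fin.≟ k
      ... | yes ≡.refl = cₗ≈0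
      ... | no ¬e = ≡.subst (λ k → c (suc k) ≈ 0#) (punchIn-punchOut ¬e) (d≈0 (punchOut ¬e))

    -- The system is block triangular. Edges avoiding `u` and `v′` involve only `rest`, which gives
    -- `d≈0`; after that, one edge from each `w` to `u` or `v′` shows that `a` is a relation among
    -- the rows of `Y`.
    minors-independent : (Adj : Rel (Fin (2 ℕ.+ m)) 0ℓ) →
      (∀ w → Adj u (outside u v w) ⊎ Adj v′ (outside u v w)) →
      Independent Y → Independent (minorRows (Adj on outside u v) Y) →
      Independent (minorRows Adj X)
    minors-independent Adj dom indY indMinors c e k =
      ≡.subst (λ k → c k ≈ 0#) (Fin.join-splitAt m (size m) k) (all (splitAt m k))
      where
      first : Vector (Edge Adj → Carrier) m
      first b (e , _) = minor R X (zero , inner b) e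
      rest : Vector (Edge Adj → Carrier) (size m)
      rest k (e , _) = minor R X (Product.map inner inner (pair m k)) e
      a = c ∘ (_↑ˡ size m)
      d = c ∘ (m ↑ʳ_)
      rows : ∀ k j → minorRows Adj X k j ≈ (first ++ rest) k j
      rows k j with splitAt m k
      ... | inj₁ _ = refl
      ... | inj₂ _ = refl
      split : ∀ j → (a ∙ first) j + (d ∙ rest) j ≈ 0#
      split j = trans (sym (∙-++ c first rest j))
        (trans (∙-congʳ c (first ++ rest) j (minorRows Adj X) j (λ k → sym (rows k j))) (e j))
      d≈0 : ∀ k → d k ≈ 0#
      d≈0 = indMinors d λ { ((i , j) , adj) →
        let o = (outside u v i , outside u v j) , adj in
        trans (∙-congʳ d (minorRows (Adj on outside u v) Y) ((i , j) , adj) rest o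
                (λ k → sym (minor-outside k i j)))
        (trans (sym (trans (+-congʳ (∙-≈0ʳ a first o (λ b → minor-zero-outside b i j))) (+-identityˡ _)))
               (split o)) }
      a∙Y : ∀ w → (a ∙ Y) w ≈ 0#
      a∙Y w = [ at (reflexive (spread-u _ _ _)) , at (reflexive (spread-v _ _ _)) ]′ (dom w)
        where
        at : ∀ {x} → X zero x ≈ 1# → Adj x (outside u v w) → (a ∙ Y) w ≈ 0#
        at {x} X₀≈1 adj =
          let o = (x , outside u v w) , adj in
          trans (∙-congʳ a Y w first o (λ b → sym (minor-pivot X₀≈1 b w)))
          (trans (sym (trans (+-congˡ (∙-≈0ˡ rest o d≈0)) (+-identityʳ _))) (split o))
      all : ∀ s → c (join m (size m) s) ≈ 0#
      all (inj₁ b) = indY a a∙Y b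
      all (inj₂ k) = d≈0 k

  -- Independence of `X` itself is carried through the induction because the step for the minors
  -- relies on it for the smaller matrix.
  specialisation : ∀ n (Adj : Rel (Fin n) 0ℓ) → Decidable Adj → Mantelian Adj →
    ∃ λ X → Independent X × Independent (minorRows Adj X)
  specialisation zero          Adj adj? mantelian = (λ ()) , (λ c _ ()) , (λ c _ ())
  specialisation (suc zero)    Adj adj? mantelian =
    (λ _ _ → 1#) ,
    (λ { c e zero → trans (sym (trans (+-identityʳ _) (*-identityʳ _))) (e zero) }) ,
    (λ c _ ())
  specialisation (suc (suc m)) Adj adj? mantelian
    with u , v , dom ← dominatingPair Adj adj? mantelian
    with Y , indY , indMinors ← specialisation m (Adj on outside u v)
      (λ i j → adj? (outside u v i) (outside u v j))
      (λ i j k i≢j j≢k i≢k → mantelian _ _ _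
        (i≢j ∘ outside-injective u v) (j≢k ∘ outside-injective u v) (i≢k ∘ outside-injective u v))
    = X , X-independent indY , minors-independent Adj dom indY indMinors
    where
    open Step u v Y

-- The enumeration reaches all of B(n)

toℕ-punchIn-last : ∀ {m} (b : Fin m) → toℕ (punchIn (fromℕ m) b) ≡ toℕ b
toℕ-punchIn-last zero    = ≡.refl
toℕ-punchIn-last (suc b) = ≡.cong suc (toℕ-punchIn-last b)

inner-mono : ∀ {m} {a b : Fin m} → a Fin.< b → inner a Fin.< inner b
inner-mono {a = a} {b} a<b =
  ℕ.s≤s (≡.subst₂ _<_ (≡.sym (toℕ-punchIn-last a)) (≡.sym (toℕ-punchIn-last b)) a<b)

pair-increasing : ∀ n k → proj₁ (pair n k) Fin.< proj₂ (pair n k)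
pair-increasing (suc (suc m)) k with splitAt m k
... | inj₁ b = ℕ.s≤s ℕ.z≤n
... | inj₂ l = inner-mono (pair-increasing m l)

inner-onto : ∀ {m} (b : Fin (suc m)) → toℕ b < m → ∃ λ a → inner a ≡ suc b
inner-onto {m} b b<m = punchOut last≢b , ≡.cong suc (punchIn-punchOut last≢b)
  where
  last≢b : fromℕ m ≢ b
  last≢b e = ℕ.<-irrefl (≡.trans (≡.sym (≡.cong toℕ e)) (Fin.toℕ-fromℕ m)) b<m

pair-onto : ∀ n (a b : Fin n) → a Fin.< b → suc (toℕ a) ℕ.+ suc (toℕ b) ℕ.≤ n →
            ∃ λ k → pair n k ≡ (a , b)
pair-onto (suc zero) zero zero () _
pair-onto (suc (suc m)) zero (suc b) _ (ℕ.s≤s (ℕ.s≤s b<m))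
  with b′ , e ← inner-onto b b<m = b′ ↑ˡ size m , pair≡
  where
  pair≡ : pair (suc (suc m)) (b′ ↑ˡ size m) ≡ (zero , suc b)
  pair≡ rewrite Fin.splitAt-↑ˡ m b′ (size m) = ≡.cong (zero ,_) e
pair-onto (suc (suc m)) (suc a) (suc b) (ℕ.s≤s a<b) (ℕ.s≤s (ℕ.s≤s sum≤m))
  -- Both labels drop by one and the bound by two. The new bound also keeps `a` and `b` below `m`,
  -- so neither `suc a` nor `suc b` is the last index and both come from `inner`.
  with sum≤m′ ← ≡.subst (ℕ._≤ m) (ℕ.+-suc (toℕ a) (suc (toℕ b))) sum≤m
  with a′ , ≡.refl ← inner-onto a (ℕ.m+n≤o⇒m≤o (suc (toℕ a)) sum≤m′)
     | b′ , ≡.refl ← inner-onto b (ℕ.m+n≤o⇒n≤o (suc (toℕ a)) sum≤m′)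
  with l , e ← pair-onto m a′ b′
         (≡.subst₂ _<_ (toℕ-punchIn-last a′) (toℕ-punchIn-last b′) a<b)
         (≡.subst₂ (λ x y → suc x ℕ.+ suc y ℕ.≤ m)
           (toℕ-punchIn-last a′) (toℕ-punchIn-last b′) sum≤m′)
  = m ↑ʳ l , pair≡
  where
  pair≡ : pair (suc (suc m)) (m ↑ʳ l) ≡ (inner a′ , inner b′)
  pair≡ rewrite Fin.splitAt-↑ʳ m (size m) l = ≡.cong (Product.map inner inner) e

KSubset-≡ : ∀ {n k} {S T : KSubset n k} → elems S ≡ elems T → S ≡ T
KSubset-≡ ≡.refl = ≡.refl

doubleton : ∀ {n} (i j : Fin n) → i Fin.< j → KSubset n 2
doubleton {n} i j i<j = ksubset xs inc
  where
  xs : Vec (Fin n) 2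
  xs = i ∷ j ∷ []
  inc : ∀ {a b} → a Fin.< b → lookup xs a Fin.< lookup xs b
  inc {zero} {suc zero} _ = i<j
  inc {suc zero} {suc zero} (ℕ.s≤s ())

subsetB : ∀ n → Fin (size n) → KSubset n 2
subsetB n k = doubleton (proj₁ (pair n k)) (proj₂ (pair n k)) (pair-increasing n k)

subsetB-onto : ∀ {n} S → S ∈ B n → ∃ λ k → subsetB n k ≡ S
subsetB-onto {n} (ksubset (a ∷ b ∷ []) a<b) S∈B
  -- The monotonicity proof in a `KSubset` is irrelevant; decidability of `a < b` makes it usable.
  with k , e ← pair-onto n a b (recompute (a Fin.<? b) (a<b {zero} {suc zero} (ℕ.s≤s ℕ.z≤n))) S∈B
  = k , KSubset-≡ (≡.cong (λ p → proj₁ p ∷ proj₂ p ∷ []) e)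

tripleton : ∀ {n} (i j k : Fin n) → i Fin.< j → j Fin.< k → KSubset n 3
tripleton {n} i j k i<j j<k = ksubset xs inc
  where
  xs : Vec (Fin n) 3
  xs = i ∷ j ∷ k ∷ []
  inc : ∀ {a b} → a Fin.< b → lookup xs a Fin.< lookup xs b
  inc {zero}         {suc zero}       _ = i<j
  inc {zero}         {suc (suc zero)} _ = Fin.<-trans i<j j<k
  inc {suc zero}     {suc (suc zero)} _ = j<k
  inc {suc zero} {suc zero} (ℕ.s≤s ())
  inc {suc (suc zero)} {suc zero} (ℕ.s≤s ())
  inc {suc (suc zero)} {suc (suc zero)} (ℕ.s≤s (ℕ.s≤s ()))

-- From 3-subsets to arbitrary triples of distinct vertices

module _ {n} (G : Graph n) where
  open Graph G

  EdgeAmong : Fin n → Fin n → Fin n → Set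
  EdgeAmong i j k = Adj i j ⊎ Adj j k ⊎ Adj i k

  module _ (meets : ∀ (T : KSubset n 3) → ∃ λ S → E G S × S ⊆ₛ T) where

    edgeAmong-increasing : ∀ {i j k} → i Fin.< j → j Fin.< k → EdgeAmong i j k
    edgeAmong-increasing {i} {j} {k} i<j j<k
      with S , adj , S⊆T ← meets (tripleton i j k i<j j<k)
      = among (S⊆T (∈-lookup zero (elems S))) (S⊆T (∈-lookup (suc zero) (elems S))) adj
      where
      among : ∀ {x y} → x ∈ᵥ (i ∷ j ∷ k ∷ []) → y ∈ᵥ (i ∷ j ∷ k ∷ []) → Adj x y → EdgeAmong i j k
      among (here ≡.refl)                 (here ≡.refl)                 a = ⊥-elim (adj-irrefl ≡.refl a)
      among (here ≡.refl)                 (there (here ≡.refl))         a = inj₁ a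
      among (here ≡.refl)                 (there (there (here ≡.refl))) a = inj₂ (inj₂ a)
      among (there (here ≡.refl))         (here ≡.refl)                 a = inj₁ (adj-sym a)
      among (there (here ≡.refl))         (there (here ≡.refl))         a = ⊥-elim (adj-irrefl ≡.refl a)
      among (there (here ≡.refl))         (there (there (here ≡.refl))) a = inj₂ (inj₁ a)
      among (there (there (here ≡.refl))) (here ≡.refl)                 a = inj₂ (inj₂ (adj-sym a))
      among (there (there (here ≡.refl))) (there (here ≡.refl))         a = inj₂ (inj₁ (adj-sym a))
      among (there (there (here ≡.refl))) (there (there (here ≡.refl))) a = ⊥-elim (adj-irrefl ≡.refl a)

    -- Adjacent transpositions, which carry the increasing case to all six orders of a triple.
    swap₁₂ : ∀ {i j k} → EdgeAmong i j k → EdgeAmong j i k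
    swap₁₂ = [ inj₁ ∘ adj-sym , [ inj₂ ∘ inj₂ , inj₂ ∘ inj₁ ]′ ]′

    swap₂₃ : ∀ {i j k} → EdgeAmong i j k → EdgeAmong i k j
    swap₂₃ = [ inj₂ ∘ inj₂ , [ inj₂ ∘ inj₁ ∘ adj-sym , inj₁ ]′ ]′

    mantelian : Mantelian Adj
    mantelian i j k i≢j j≢k i≢k with Fin.<-cmp i j | Fin.<-cmp j k | Fin.<-cmp i k
    ... | tri≈ _ i≡j _ | _ | _ = ⊥-elim (i≢j i≡j)
    ... | _ | tri≈ _ j≡k _ | _ = ⊥-elim (j≢k j≡k)
    ... | _ | _ | tri≈ _ i≡k _ = ⊥-elim (i≢k i≡k)
    ... | tri< i<j _ _ | tri< j<k _ _ | _            = edgeAmong-increasing i<j j<k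
    ... | tri< _ _ _   | tri> _ _ k<j | tri< i<k _ _ = swap₂₃ (edgeAmong-increasing i<k k<j)
    ... | tri< i<j _ _ | tri> _ _ _   | tri> _ _ k<i = swap₂₃ (swap₁₂ (edgeAmong-increasing k<i i<j))
    ... | tri> _ _ j<i | tri< _ _ _   | tri< i<k _ _ = swap₁₂ (edgeAmong-increasing j<i i<k)
    ... | tri> _ _ _   | tri< j<k _ _ | tri> _ _ k<i = swap₁₂ (swap₂₃ (edgeAmong-increasing j<k k<i))
    ... | tri> _ _ j<i | tri> _ _ k<j | _            =
      swap₁₂ (swap₂₃ (swap₁₂ (edgeAmong-increasing k<j j<i)))

-- Independence of the rows of the generic compound matrix

module _ {n} (G : Graph n) (G-mantelian : Mantelian (Graph.Adj G)) where
  open Graph G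
  private
    Poly = ℚ[x] (n ℕ.* n)
    module Poly = IntegralDomain Poly
    K = ℚ⟨x⟩ (n ℕ.* n)
    module K = CommutativeRing K
    module IK = Independence K
    module Iℚ = Independence ℚ.commutativeRing
    open FractionField Poly using (embed)
    open Embedding Poly

  X : Fin n → Fin n → Poly.Carrier
  X i j = var (combine i j)

  -- The entries are kept as polynomials, so that they can be both evaluated and embedded into the
  -- field.
  genericRows : Vector (∃ (E G) → Poly.Carrier) (size n)
  genericRows k (T , _) = minor Poly.commutativeRing X (pair n k) (members T)

  compoundRow : KSubset n 2 → ∃ (E G) → K.Carrier
  compoundRow S (T , _) = compound n 2 S T

  rows-independent : IK.Independent (compoundRow ∘ subsetB n)
  rows-independent
    with X₀ , _ , ind ←
      Specialisation.specialisation ℚ.commutativeRing n Adj adj? G-mantelian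
    = λ c e → transfer φ-hom embed-isHom (λ _ → ≃0-stable) torsionFree genericRows φ-independent c
        λ j → K.trans (IK.∙-congʳ c (λ k j → embed (genericRows k j)) j (compoundRow ∘ subsetB n) j
                         (λ k → embed-row k j)) (e j)
    where
    open Transfer Poly.commutativeRing ℚ-domain K
    -- `remQuot` inverts `combine`, so the variable in position (i, j) receives the value `X₀ i j`.
    point : Fin (n ℕ.* n) → ℚ.Carrier
    point i = uncurry X₀ (remQuot n i)
    φ = proj₁ (evaluation point)
    φ-hom = proj₂ (evaluation point)
    -- A polynomial with a nonzero value is nonzero, hence can be cancelled in the field of
    -- fractions.
    torsionFree : ∀ x y → ¬ (φ x ≡ ℚ.0#) → embed x K.* y K.≈ K.0# → y K.≈ K.0#
    torsionFree x y φx≢0 = embed-torsionFree x y λ x≈0 →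
      φx≢0 (≡.trans (φ.⟦⟧-cong x≈0) φ.0#-homo)
      where module φ = RingMorphisms.IsRingHomomorphism φ-hom
    embed-row : ∀ k j → embed (genericRows k j) K.≈ compoundRow (subsetB n k) j
    embed-row k (T , _) = K.trans
      (hom-minor Poly.commutativeRing K embed-isHom X (pair n k) (members T))
      (K.sym (det-minor K (λ i j → embed (X i j)) (subsetB n k) T))
    φ-X : ∀ i j → φ (X i j) ≡ X₀ i j
    φ-X i j = ≡.trans (evaluation-var point (combine i j))
      (≡.cong (uncurry X₀) (Fin.remQuot-combine i j))
    φ-row : ∀ k i j → φ (minor Poly.commutativeRing X (pair n k) (i , j))
                      ≡ minor ℚ.commutativeRing X₀ (pair n k) (i , j)
    φ-row k i j = ≡.trans
      (hom-minor Poly.commutativeRing ℚ.commutativeRing φ-hom X (pair n k) (i , j))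
      (ℚ.+-cong (≡.cong₂ ℚ._*_ (φ-X _ _) (φ-X _ _))
               (≡.cong ℚ.-_ (≡.cong₂ ℚ._*_ (φ-X _ _) (φ-X _ _))))
    φ-independent : Iℚ.Independent (λ k j → φ (genericRows k j))
    φ-independent c e = ind c vanish
      where
      rows = Specialisation.minorRows ℚ.commutativeRing Adj X₀
      vanish-< : ∀ i j → i Fin.< j → (adj : Adj i j) → (c Iℚ.∙ rows) ((i , j) , adj) ≡ ℚ.0#
      vanish-< i j i<j adj =
        let T = doubleton i j i<j , adj in
        ≡.trans (Iℚ.∙-congʳ c rows ((i , j) , adj) (λ k j → φ (genericRows k j)) T
                   (λ k → ≡.sym (φ-row k i j)))
                (e T)
      -- `ind` asks for the relation at both orientations of an edge, while `e` gives it at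
      -- increasing pairs; reversing a pair changes the sign of every minor in that column.
      vanish : ∀ j → (c Iℚ.∙ rows) j ≡ ℚ.0#
      vanish ((i , j) , adj) with Fin.<-cmp i j
      ... | tri< i<j _ _    = vanish-< i j i<j adj
      ... | tri≈ _ i≡j _    = ⊥-elim (adj-irrefl i≡j adj)
      ... | tri> _ _ j<i    = Iℚ.∙-antisymmetric c rows ((i , j) , adj) ((j , i) , adj-sym adj)
        (λ k → minor-antisymmetric ℚ.commutativeRing X₀ (pair n k) i j)
        (vanish-< j i j<i (adj-sym adj))

-- The greedy selection contains B(n)

mainTheorem4 : ∀ (n : ℕ) (_<t_ : Rel (KSubset n 2) 0ℓ) (termOrder : IsTermOrder _<t_) →
    (∀ S T → labelSum S < labelSum T → S <t T) →
    ∀ (G : Graph n) →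
    (∀ (T : KSubset n 3) → ∃ λ S → S ∈ E G × S ⊆ₛ T) →
    B n ⊆ exteriorShift n _<t_ (E G) termOrder
mainTheorem4 n _<t_ termOrder refines G meets {S} S∈B =
  selected (termOrder-wellFounded termOrder S)
  where
  open IsStrictTotalOrder (IsTermOrder.isStrictTotalOrder termOrder) using (irrefl; asym)
  open Independence (ℚ⟨x⟩ (n ℕ.* n)) using (IndexedAwayFrom; independent⇒∉span)
  open CommutativeRing (ℚ⟨x⟩ (n ℕ.* n)) using (_≈_)
  open LinearAlgebra (ℚ⟨x⟩ (n ℕ.* n)) using (combination)

  rows : KSubset n 2 → ∃ (E G) → _
  rows = row n _<t_ (E G)

  k₀ : Fin (size n)
  k₀ = proj₁ (subsetB-onto S S∈B)

  subsetB-k₀ : subsetB n k₀ ≡ S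
  subsetB-k₀ = proj₂ (subsetB-onto S S∈B)

  -- If `T` had the larger label sum, `refines` would place `S` before `T`; so `T` satisfies the
  -- bound that `S` does.
  earlier : ∀ {T} → T <t S → IndexedAwayFrom rows (subsetB n) k₀ T
  earlier {T} T<S
    with k , e ← subsetB-onto T
           (ℕ.≤-trans (ℕ.≮⇒≥ λ S<T → asym T<S (refines S T S<T)) S∈B)
    = k , e , λ k₀≡k →
      irrefl (≡.trans (≡.sym e) (≡.trans (≡.cong (subsetB n) (≡.sym k₀≡k)) subsetB-k₀)) T<S

  -- The row of `S` lies outside the span of all rows `T <t S`, selected or not. Quantifying over
  -- `a` lets the match on `acc` unfold `Selected`.
  selected : (a : Acc _<t_ S) → Selected n _<t_ (E G) S a
  selected (acc rs) (cs , ps , e) =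
    independent⇒∉span rows (subsetB n) k₀ (Embedding.1≄0 (ℚ[x] (n ℕ.* n)))
      (rows-independent G (mantelian G meets)) cs
      (All.map (earlier ∘ proj₁) ps)
      (≡.subst (λ S′ → ∀ j → rows S′ j ≈ combination rows cs j) (≡.sym subsetB-k₀) e)
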